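{- Let $M\in\mathbb R^{m\times n}$ be a hidden K-matrix of type $a\in\mathbb N^n$, let $S$ be an $n\times n$ signature matrix and let $q\in\mathbb R^m$. Then the P-GLCP$(\mathbf SMS,\mathbf Sq)$ describes, in terms of combinatorics, a two-player stochastic game of type $a+\mathbf 1$: assuming nondegeneracy, there is a two-player stochastic game with perfect information of type $a+\mathbf 1$ such that the USO of the grid $G(a+\mathbf 1)$ arising from the game equals the USO arising from the P-GLCP$(\mathbf SMS,\mathbf Sq)$.
   Context: Write $[n]=\{1,\dots,n\}$; $\mathbf 1$ is the all-ones vector; $\mathbb N$ the positive integers. A block matrix of type $b=(b_1,\dots,b_n)$ is a real $m\times n$ matrix, $m=\sum_jb_j$, whose rows are partitioned into $n$ consecutive blocks, block $j$ having $b_j$ rows; rows are indexed by $N(b)=\{(j,i): j\in[n], i\in[b_j]\}$. $B\subseteq N(b)$ is maximal complementary if it contains exactly one $(j,i)$ for each $j$; then the $n\times n$ matrix $M_B$ of rows in $B$ is a representative submatrix. A square matrix is a P-matrix if all principal minors are positive, a Z-matrix if off-diagonal entries are nonpositive; a block matrix is a P-matrix (Z-matrix) if every representative submatrix is. $M$ of type $b$ is a hidden Z-matrix if there are a square Z-matrix $X\in\mathbb R^{n\times n}$, a block Z-matrix $Y$ of type $b$, and $r,s\ge\mathbf 0$ with $MX=Y$ and $X^Tr+Y^Ts>\mathbf 0$; it is a hidden K-matrix if it is moreover a P-matrix. A signature matrix $S$ is diagonal with entries $s_{jj}\in\{ -1,1\}$; $\mathbf S$ is the block diagonal matrix with $j$-th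 block $s_{jj}I$ of the size of block $j$. $E(b)$ is the block matrix of type $b$ all of whose representative submatrices are the identity. GLCP$(M,q)$ of type $b$: find $z\in\mathbb R^n$, $w\in\mathbb R^m$ with $w-Mz=q$, $w,z\ge\mathbf 0$, $z_j\prod_{i=1}^{b_j}w^j_i=0$ for all $j$. It is a P-GLCP if $M$ is a block P-matrix. $[I|-M]$ is the $m\times(m+n)$ matrix with columns indexed by $N(b+\mathbf 1)$: column $(j,i)$, $i\le b_j$, is the unit vector $e_{(j,i)}$, and column $(j,b_j+1)$ is minus the $j$-th column of $M$. The grid $G(b)$ is the graph whose vertices are the maximal complementary subsets of $N(b)$, two being adjacent if they differ in exactly one element. A subgrid is the subgraph induced by the vertices contained in some subset of $N(b)$. A unique-sink orientation (USO) is an orientation of the edges such that every (nonempty) subgrid has a unique sink. The USO arising from a P-GLCP$(M,q)$ of type $b$ is the orientation of $G(b+\mathbf 1)$ in which, for adjacent $B$ and $C=(B\setminus\{(j,i)\})\cup\{(j,k)\}$, $B\to C$ iff $([I|-M]_N^{ -1}q)^j_k<0$, where $N=N(b+\mathbf 1)\setminus B$ and the vector is indexed by $N$; nondegeneracy means that all these vectors have no zero entry. Two-player stochastic game of type $c\in\mathbb N^n$: $n$ states partitioned as $[n]=S_{\max}\cup S_{\min}$; state $j$ has actions $i\in[c_j]$ with rewards $r^j_i\in\mathbb R$ and transition probabilities $p^j_{ik}\ge0$, $\sum_kp^j_{ik}=1$; discount factor $\gamma\in[0,1)$. Let $P=(p^j_{ik})$ and $r=(r^j_i)$ be the corresponding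 block matrix and vector of type $c$. If $c=a+\mathbf 1$, put $C=\{(j,a_j+1): j\in[n]\}$, let $\overline C$ be its complement in $N(c)$, and let $s_{jj}=1$ for $j\in S_{\max}$, $s_{jj}=-1$ for $j\in S_{\min}$. The USO arising from the game is the one arising from the P-GLCP$(\mathbf SM'S,\mathbf Sq')$ of type $a$ with $M'=(E(a)-\gamma P_{\overline C})(I-\gamma P_C)^{ -1}$ and $q'=M'r_C-r_{\overline C}$. -}

module Defs where

open import Algebra.Bundles using (CommutativeRing; Semiring)
import Algebra.Definitions.RawSemiring as RawSemiringDefinitions
open import Data.Fin.Base as Fin using (Fin; zero; suc; toℕ; fromℕ; inject₁; punchIn; punchOut)
import Data.Fin.Properties as Fin
open import Data.Fin.Relation.Unary.Top using (view; ‵fromℕ; ‵inject₁)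
open import Data.Nat.Base using (ℕ; zero; suc)
open import Data.Product.Base using (Σ; ∃; _×_; _,_)
open import Data.Product.Properties using (≡-dec)
open import Data.Sum.Base using (_⊎_)

open import Function.Bundles using (_⇔_)
open import Level using (Level; _⊔_) renaming (suc to lsuc)
open import Relation.Binary.Core using (Rel; _Preserves_⟶_)
open import Relation.Binary.Definitions using (DecidableEquality)
open import Relation.Binary.PropositionalEquality.Core using (_≡_; _≢_)
open import Relation.Binary.Structures using (IsStrictTotalOrder)
import Relation.Binary.Construct.StrictToNonStrict as StrictToNonStrict
open import Relation.Nullary.Decidable.Core using (yes; no)
open import Relation.Nullary.Negation.Core using (¬_)
open import Relation.Unary using (Pred)

-- The real numbers, given by their axioms: a Dedekind-complete totally
-- ordered field.  Trichotomy is part of IsStrictTotalOrder, i.e. these are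
-- the classical reals.

record RealNumbers (c ℓ₁ ℓ₂ : Level) : Set (lsuc (c ⊔ ℓ₁ ⊔ ℓ₂)) where
  field
    commutativeRing : CommutativeRing c ℓ₁

  open CommutativeRing commutativeRing public

  infix 4 _<_ _≤_
  field
    _<_                : Rel Carrier ℓ₂
    isStrictTotalOrder : IsStrictTotalOrder _≈_ _<_
    0≉1                : ¬ (0# ≈ 1#)
    invertible         : ∀ x → ¬ (x ≈ 0#) → ∃ λ y → x * y ≈ 1#
    +-monoˡ-<          : ∀ x y z → x < y → x + z < y + z
    *-pos              : ∀ x y → 0# < x → 0# < y → 0# < x * y

  _≤_ : Rel Carrier (ℓ₁ ⊔ ℓ₂)
  _≤_ = StrictToNonStrict._≤_ _≈_ _<_

  UpperBound : Pred Carrier (c ⊔ ℓ₁ ⊔ ℓ₂) → Carrier → Set (c ⊔ ℓ₁ ⊔ ℓ₂)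
  UpperBound P u = ∀ x → P x → x ≤ u

  field
    complete : (P : Pred Carrier (c ⊔ ℓ₁ ⊔ ℓ₂)) → ∃ P → ∃ (UpperBound P) →
               ∃ λ s → UpperBound P s × (∀ u → UpperBound P u → s ≤ u)

-- A type b ∈ ℕⁿ is a function Fin n → ℕ.  (Positivity of its entries is a
-- separate hypothesis where it matters.)

Type : ℕ → Set
Type n = Fin n → ℕ

_+𝟏 : ∀ {n} → Type n → Type n
(b +𝟏) j = suc (b j)

N : ∀ {n} → Type n → Set
N {n} b = Σ (Fin n) λ j → Fin (b j)

_≟ᴺ_ : ∀ {n} {b : Type n} → DecidableEquality (N b)
_≟ᴺ_ = ≡-dec Fin._≟_ Fin._≟_

-- A maximal complementary subset of N(b), given by the unique i with
-- (j , i) ∈ B for each j.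

MaxCompl : ∀ {n} → Type n → Set
MaxCompl {n} b = (j : Fin n) → Fin (b j)

-- The enumeration of N(b + 𝟏) ∖ B by N(b), preserving the order within each
-- block.

outside : ∀ {n} {b : Type n} → MaxCompl (b +𝟏) → N b → N (b +𝟏)
outside B (j , i) = j , punchIn (B j) i

-- Edges of the grid G(b): C = (B ∖ {(j , B j)}) ∪ {(j , C j)} for j = block.

record Adjacent {n} {b : Type n} (B C : MaxCompl b) : Set where
  field
    block   : Fin n
    differ  : B block ≢ C block
    agree   : ∀ l → l ≢ block → B l ≡ C l

-- The element of C not in B, as an element of N(b + 𝟏) ∖ B; its image under
-- outside B is (block , C block).

entering : ∀ {n} {b : Type n} {B C : MaxCompl (b +𝟏)} → Adjacent B C → N b
entering e = block , punchOut differ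
  where open Adjacent e

data Player : Set where
  max min : Player

module Real {c ℓ₁ ℓ₂} (ℝ : RealNumbers c ℓ₁ ℓ₂) where

  open RealNumbers ℝ using (Carrier; _≈_; _<_; _≤_; _+_; _*_; _-_; -_; 0#; 1#; semiring)
  open RawSemiringDefinitions (Semiring.rawSemiring semiring) using (sum; _^_)

  -- Matrices with row index set I and column index set J.

  Matrix : Set → Set → Set c
  Matrix I J = I → J → Carrier

  Vec : Set → Set c
  Vec I = I → Carrier

  Square : ℕ → Set c
  Square n = Matrix (Fin n) (Fin n)

  BlockMatrix : ∀ {n} → Type n → Set c
  BlockMatrix {n} b = Matrix (N b) (Fin n)

  sumᴺ : ∀ {n} {b : Type n} → (N b → Carrier) → Carrier
  sumᴺ f = sum λ j → sum λ i → f (j , i)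

  -- Products whose summation index ranges over Fin n, respectively N(b).

  infixl 7 _·_ _·ᴺ_ _·ᵛ_ _·ᴺᵛ_

  _·_ : ∀ {n} {I K : Set} → Matrix I (Fin n) → Matrix (Fin n) K → Matrix I K
  (A · B) i k = sum λ j → A i j * B j k

  _·ᴺ_ : ∀ {n} {b : Type n} {I K : Set} → Matrix I (N b) → Matrix (N b) K → Matrix I K
  (A ·ᴺ B) i k = sumᴺ λ r → A i r * B r k

  _·ᵛ_ : ∀ {n} {I : Set} → Matrix I (Fin n) → Vec (Fin n) → Vec I
  (A ·ᵛ x) i = sum λ j → A i j * x j

  _·ᴺᵛ_ : ∀ {n} {b : Type n} {I : Set} → Matrix I (N b) → Vec (N b) → Vec I
  (A ·ᴺᵛ x) i = sumᴺ λ r → A i r * x r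

  infixl 6 _⊖_
  _⊖_ : ∀ {I J : Set} → Matrix I J → Matrix I J → Matrix I J
  (A ⊖ B) i j = A i j - B i j

  infixr 8 _∙_
  _∙_ : ∀ {I J : Set} → Carrier → Matrix I J → Matrix I J
  (x ∙ A) i j = x * A i j

  infix 8 _ᵀ
  _ᵀ : ∀ {I J : Set} → Matrix I J → Matrix J I
  (A ᵀ) j i = A i j

  infix 4 _≋_
  _≋_ : ∀ {I J : Set} → Rel (Matrix I J) ℓ₁
  A ≋ B = ∀ i j → A i j ≈ B i j

  Id : ∀ {n} → Square n
  Id j l with j Fin.≟ l
  ... | yes _ = 1#
  ... | no  _ = 0#

  Idᴺ : ∀ {n} {b : Type n} → Matrix (N b) (N b)
  Idᴺ r t with r ≟ᴺ t
  ... | yes _ = 1#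
  ... | no  _ = 0#

  IsInverse : ∀ {n} → Square n → Square n → Set ℓ₁
  IsInverse A V = (A · V ≋ Id) × (V · A ≋ Id)

  IsInverseᴺ : ∀ {n} {b : Type n} → Matrix (N b) (N b) → Matrix (N b) (N b) → Set ℓ₁
  IsInverseᴺ A V = (A ·ᴺ V ≋ Idᴺ) × (V ·ᴺ A ≋ Idᴺ)

  -- Laplace expansion along the first row.

  det : ∀ {n} → Square n → Carrier
  det {zero}  A = 1#
  det {suc n} A =
    sum λ j → (- 1#) ^ toℕ j * (A zero j * det λ i k → A (suc i) (punchIn j k))

  -- A principal submatrix is selected by listing its index set increasingly.

  IsP : ∀ {n} → Square n → Set ℓ₂
  IsP {n} A = ∀ k (α : Fin k → Fin n) → α Preserves Fin._<_ ⟶ Fin._<_ →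
              0# < det λ i j → A (α i) (α j)

  IsZ : ∀ {n} → Square n → Set (ℓ₁ ⊔ ℓ₂)
  IsZ A = ∀ i j → i ≢ j → A i j ≤ 0#

  representative : ∀ {n} {b : Type n} → BlockMatrix b → MaxCompl b → Square n
  representative M B j = M (j , B j)

  IsBlockP : ∀ {n} {b : Type n} → BlockMatrix b → Set ℓ₂
  IsBlockP {b = b} M = (B : MaxCompl b) → IsP (representative M B)

  IsBlockZ : ∀ {n} {b : Type n} → BlockMatrix b → Set (ℓ₁ ⊔ ℓ₂)
  IsBlockZ {b = b} M = (B : MaxCompl b) → IsZ (representative M B)

  record IsHiddenZ {n} {b : Type n} (M : BlockMatrix b) : Set (c ⊔ ℓ₁ ⊔ ℓ₂) where
    field
      X   : Square n
      Y   : BlockMatrix b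
      r   : Vec (Fin n)
      s   : Vec (N b)
      X-Z : IsZ X
      Y-Z : IsBlockZ Y
      r≥0 : ∀ j → 0# ≤ r j
      s≥0 : ∀ i → 0# ≤ s i
      MX≋Y : M · X ≋ Y
      pos  : ∀ j → 0# < (X ᵀ ·ᵛ r) j + (Y ᵀ ·ᴺᵛ s) j

  IsHiddenK : ∀ {n} {b : Type n} → BlockMatrix b → Set (c ⊔ ℓ₁ ⊔ ℓ₂)
  IsHiddenK M = IsHiddenZ M × IsBlockP M

  E : ∀ {n} (b : Type n) → BlockMatrix b
  E b (j , i) = Id j

  IsSignature : ∀ {n} → Square n → Set ℓ₁
  IsSignature S = (∀ j → S j j ≈ - 1# ⊎ S j j ≈ 1#) × (∀ j l → j ≢ l → S j l ≈ 0#)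

  -- The block diagonal matrix 𝐒 belonging to a signature matrix S.

  blockSignature : ∀ {n} (b : Type n) → Square n → Matrix (N b) (N b)
  blockSignature b S r@(j , _) t = S j j * Idᴺ r t

  -- [ I | - M ]: in block j, the last column (j , b_j + 1) is minus the j-th
  -- column of M, the others are unit vectors.

  [I∣-_] : ∀ {n} {b : Type n} → BlockMatrix b → Matrix (N b) (N (b +𝟏))
  [I∣- M ] r (j , k) with view k
  ... | ‵fromℕ     = - M r j
  ... | ‵inject₁ i = Idᴺ r (j , i)

  -- The columns of [ I | - M ] outside B.

  nonbasis : ∀ {n} {b : Type n} → BlockMatrix b → MaxCompl (b +𝟏) → Matrix (N b) (N b)
  nonbasis M B r k = [I∣- M ] r (outside B k)

  -- No entry of [ I | - M ]_N ⁻¹ q vanishes, for every complement N of a vertex.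

  Nondegenerate : ∀ {n} {b : Type n} → BlockMatrix b → Vec (N b) → Set (c ⊔ ℓ₁)
  Nondegenerate {b = b} M q =
    (B : MaxCompl (b +𝟏)) (V : Matrix (N b) (N b)) → IsInverseᴺ (nonbasis M B) V →
    ∀ k → ¬ ((V ·ᴺᵛ q) k ≈ 0#)

  -- O e, for an edge e between B and C, says that e is directed from B to C.

  Orientation : ∀ {n} → Type n → Set (lsuc (c ⊔ ℓ₁ ⊔ ℓ₂))
  Orientation b = {B C : MaxCompl b} → Adjacent B C → Set (c ⊔ ℓ₁ ⊔ ℓ₂)

  -- O is the orientation arising from the P-GLCP (M , q).  The inverse V
  -- exists and is unique because M is a P-matrix.  That such an orientation
  -- has a unique sink in each subgrid is a theorem about P-GLCPs, not part of
  -- its description.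

  record ArisesFromPGLCP {n} {b : Type n} (M : BlockMatrix b) (q : Vec (N b))
                         (O : Orientation (b +𝟏)) : Set (c ⊔ ℓ₁ ⊔ ℓ₂) where
    field
      isP           : IsBlockP M
      nondegenerate : Nondegenerate M q
      direction     : ∀ {B C} (e : Adjacent B C) →
        O e ⇔ ∃ λ V → IsInverseᴺ (nonbasis M B) V × (V ·ᴺᵛ q) (entering e) < 0#

  -- A two-player stochastic game with perfect information; the partition of
  -- the states into S_max and S_min is given by owner.

  record Game {n} (t : Type n) : Set (c ⊔ ℓ₁ ⊔ ℓ₂) where
    field
      owner  : Fin n → Player
      reward : Vec (N t)
      P      : BlockMatrix t
      P≥0    : ∀ i k → 0# ≤ P i k
      ∑P≈1   : ∀ i → sum (P i) ≈ 1#
      γ      : Carrier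
      0≤γ    : 0# ≤ γ
      γ<1    : γ < 1#

    S : Square n
    S j l with owner j
    ... | max = Id j l
    ... | min = - Id j l

  -- For a game of type a + 𝟏: the rows in C, which contains the last action of
  -- each state, and the remaining rows.

  module _ {n} {a : Type n} where

    atC : ∀ {ℓ} {A : Set ℓ} → (N (a +𝟏) → A) → Fin n → A
    atC f j = f (j , fromℕ (a j))

    atC̅ : ∀ {ℓ} {A : Set ℓ} → (N (a +𝟏) → A) → N a → A
    atC̅ f (j , i) = f (j , inject₁ i)

    record ArisesFromGame (G : Game (a +𝟏)) (O : Orientation (a +𝟏)) : Set (c ⊔ ℓ₁ ⊔ ℓ₂) where
      open Game G
      field
        V         : Square n
        isInverse : IsInverse (Id ⊖ γ ∙ atC P) V

      M′ : BlockMatrix a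
      M′ = (E a ⊖ γ ∙ atC̅ P) · V

      q′ : Vec (N a)
      q′ i = (M′ ·ᵛ atC reward) i - atC̅ reward i

      field
        arises : ArisesFromPGLCP (blockSignature a S ·ᴺ M′ · S) (blockSignature a S ·ᴺᵛ q′) O

{-# OPTIONS --safe #-}

-- Let MX = Y with X, Y as in the definition of a hidden Z-matrix.  Weighting
-- the rows of X and Y by r and s gives in each block one combined row; these
-- combined rows form a square Z-matrix with positive column sums, hence a
-- K-matrix.  As M is a P-matrix, it reverses the sign of no vector, and this
-- lets the rows be exchanged one at a time, keeping a K-matrix, for the rows of
-- any selection from X and Y.  Policy iteration over all selections then gives
-- one t > 0 with Xt ≥ 𝟏 and Yt ≥ 𝟏.  Scaling the columns of X and Y by t and the
-- rows by (1 - γ) over their row sums, for γ close to 1, turns X into I - γ P_C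
-- and Y into E - γ P_C̅ with stochastic P.  So M becomes the matrix M′ of a game
-- after a positive scaling of rows and columns, which does not affect the signs
-- of basic solutions; scaled rewards match q, and the owners of the states are
-- read off S.

module Submission where

open import Algebra.Bundles using (RawRing; Semiring)
import Algebra.Definitions.RawSemiring as RawSemiringDefinitions
import Algebra.Properties.CommutativeMonoid.Sum as CommutativeMonoidSum
import Algebra.Properties.Ring as RingProperties
import Algebra.Properties.Semiring.Mult.TCOptimised as Mult
import Algebra.Properties.Semiring.Sum as SemiringSum
import Algebra.Solver.Ring as RingSolver
open import Algebra.Solver.Ring.AlmostCommutativeRing
  using (fromCommutativeRing; _-Raw-AlmostCommutative⟶_)
import Algebra.Solver.Ring.NaturalCoefficients.Default as NatSolver
open import Data.Empty using (⊥; ⊥-elim)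
open import Data.Fin.Base as Fin using (Fin; zero; suc; toℕ; fromℕ; fromℕ<; inject₁; punchIn)
import Data.Fin.Properties as Fin
open import Data.Fin.Relation.Unary.Top using (view; ‵fromℕ; ‵inject₁; view-fromℕ; view-inject₁)
open import Data.Maybe.Base using (Maybe; just; nothing)
open import Data.Nat.Base as ℕ using (ℕ; zero; suc; NonZero)
import Data.Nat.Properties as ℕ
open import Data.Product.Base using (∃; Σ-syntax; _×_; _,_; proj₁; proj₂)
open import Data.Sum.Base using (_⊎_; inj₁; inj₂)
open import Function.Base using (_∘_; id)
open import Function.Bundles using (mk⇔; Equivalence)
open import Level using (_⊔_)
open import Relation.Binary.Bundles using (StrictTotalOrder)
import Relation.Binary.Construct.StrictToNonStrict as StrictToNonStrict
open import Relation.Binary.Core using (_Preserves_⟶_)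
open import Relation.Binary.Definitions using (tri<; tri≈; tri>)
open import Relation.Binary.PropositionalEquality as ≡ using (_≡_; _≢_)
import Relation.Binary.Reasoning.Setoid as SetoidReasoning
import Relation.Binary.Reasoning.StrictPartialOrder as StrictReasoning
open import Relation.Binary.Structures using (IsStrictTotalOrder)
open import Relation.Nullary using (¬_; yes; no; contradiction)
open import Defs

-- The condition on r and s says nothing about any single selection of rows of X and Y, yet the game
-- needs one t that serves all actions at once. The combined rows supply a first selection with a
-- nonnegative witness. They arise from X by the same combinations of identity rows and rows of M,
-- so the sign argument covers them as well: nonnegative weights hand a reversal by a combined row
-- down to an identity row or a row of M, and an identity row reverses only a vector whose entry
-- there is zero. So each reversal ends in a representative submatrix of M.
--
-- The rows of X take part in the exchange because they become the actions in C: Xt ≥ 𝟏 bounds their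
-- transition probabilities, and it also gives the invertibility of X that the definition of a
-- hidden Z-matrix leaves open.
--
-- P-matrices are given by minors, whereas the exchange speaks of vectors. The bridge between the
-- two is the determinant of a Schur complement.

-- Ordered fields, a ring solver with integer coefficients, finite sums

module OrderedField {c ℓ₁ ℓ₂} (ℝ : RealNumbers c ℓ₁ ℓ₂) where

  open RealNumbers ℝ public hiding (zero)
  open RingProperties ring public using (-0#≈0#; -‿involutive; -‿distribˡ-*; -‿distribʳ-*)
  open SemiringSum semiring public
    using (sum; sum-cong-≋; ∑-comm; ∑-distrib-+; *-distribˡ-sum; *-distribʳ-sum; sum-replicate-zero; sum-remove)

  module Solver where

    open Mult semiring using (×-homo-+; ×1-homo-*) renaming (_×_ to _×ᵣ_)
    open NatSolver commutativeSemiring using (solve; _:+_; _:*_; _:=_)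

    -- The pair (m , n) stands for the integer m - n.

    reduce : ℕ × ℕ → ℕ × ℕ
    reduce (suc a , suc b) = reduce (a , b)
    reduce p               = p

    differences : RawRing _ _
    differences = record
      { Carrier = ℕ × ℕ
      ; _≈_     = _≡_
      ; _+_     = λ (a , b) (a′ , b′) → reduce (a ℕ.+ a′ , b ℕ.+ b′)
      ; _*_     = λ (a , b) (a′ , b′) → reduce (a ℕ.* a′ ℕ.+ b ℕ.* b′ , a ℕ.* b′ ℕ.+ b ℕ.* a′)
      ; -_      = λ (a , b) → b , a
      ; 0#      = 0 , 0
      ; 1#      = 1 , 0
      }

    -- The case of a zero second component is separate so that `𝟘` and `𝟙` compute to `0#` and `1#`,
    -- as the `refl` fields of `morphism` and the calls of the solver require.
    difference : ℕ × ℕ → Carrier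
    difference (a , zero)      = a ×ᵣ 1#
    difference (a , b@(suc _)) = a ×ᵣ 1# - b ×ᵣ 1#

    difference-≈ : ∀ a b → difference (a , b) ≈ a ×ᵣ 1# - b ×ᵣ 1#
    difference-≈ a zero    = sym (trans (+-congˡ -0#≈0#) (+-identityʳ _))
    difference-≈ a (suc b) = refl

    shuffle : ∀ x y z w → x + w ≈ z + y → x - y ≈ z - w
    shuffle x y z w eq = begin
      x - y                  ≈⟨ +-congʳ (+-identityʳ x) ⟨
      x + 0# - y             ≈⟨ +-congʳ (+-congˡ (-‿inverseʳ w)) ⟨
      x + (w - w) - y        ≈⟨ solve 4 (λ x w w′ y′ → x :+ (w :+ w′) :+ y′ := (x :+ w) :+ (w′ :+ y′)) refl x w (- w) (- y) ⟩
      (x + w) + (- w - y)    ≈⟨ +-congʳ eq ⟩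
      (z + y) + (- w - y)    ≈⟨ solve 4 (λ z y w′ y′ → (z :+ y) :+ (w′ :+ y′) := (z :+ w′) :+ (y :+ y′)) refl z y (- w) (- y) ⟩
      (z - w) + (y - y)      ≈⟨ +-congˡ (-‿inverseʳ y) ⟩
      (z - w) + 0#           ≈⟨ +-identityʳ _ ⟩
      z - w                  ∎
      where open SetoidReasoning setoid

    difference-reduce : ∀ a b → difference (reduce (a , b)) ≈ a ×ᵣ 1# - b ×ᵣ 1#
    difference-reduce (suc a) (suc b) = trans (difference-reduce a b) (shuffle _ _ _ _ (begin
      a ×ᵣ 1# + suc b ×ᵣ 1#    ≈⟨ ×-homo-+ 1# a (suc b) ⟨
      (a ℕ.+ suc b) ×ᵣ 1#      ≡⟨ ≡.cong (_×ᵣ 1#) (ℕ.+-suc a b) ⟩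
      (suc a ℕ.+ b) ×ᵣ 1#      ≈⟨ ×-homo-+ 1# (suc a) b ⟩
      suc a ×ᵣ 1# + b ×ᵣ 1#    ∎))
      where open SetoidReasoning setoid
    difference-reduce zero    b       = difference-≈ zero b
    difference-reduce (suc a) zero    = difference-≈ (suc a) zero

    morphism : differences -Raw-AlmostCommutative⟶ fromCommutativeRing commutativeRing
    morphism = record
      { ⟦_⟧    = difference
      ; +-homo = λ (a , b) (a′ , b′) → begin
          difference (reduce (a ℕ.+ a′ , b ℕ.+ b′))               ≈⟨ difference-reduce (a ℕ.+ a′) (b ℕ.+ b′) ⟩
          (a ℕ.+ a′) ×ᵣ 1# - (b ℕ.+ b′) ×ᵣ 1#                     ≈⟨ +-cong (×-homo-+ 1# a a′) (-‿cong (×-homo-+ 1# b b′)) ⟩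
          (a ×ᵣ 1# + a′ ×ᵣ 1#) - (b ×ᵣ 1# + b′ ×ᵣ 1#)             ≈⟨ +-congˡ (RingProperties.-‿+-comm ring _ _) ⟨
          (a ×ᵣ 1# + a′ ×ᵣ 1#) + (- (b ×ᵣ 1#) - b′ ×ᵣ 1#)         ≈⟨ solve 4 (λ x y z w → (x :+ y) :+ (z :+ w) := (x :+ z) :+ (y :+ w)) refl _ _ _ _ ⟩
          (a ×ᵣ 1# - b ×ᵣ 1#) + (a′ ×ᵣ 1# - b′ ×ᵣ 1#)             ≈⟨ +-cong (difference-≈ a b) (difference-≈ a′ b′) ⟨
          difference (a , b) + difference (a′ , b′)               ∎
      ; *-homo = λ (a , b) (a′ , b′) → begin
          difference (reduce (a ℕ.* a′ ℕ.+ b ℕ.* b′ , a ℕ.* b′ ℕ.+ b ℕ.* a′))       ≈⟨ difference-reduce (a ℕ.* a′ ℕ.+ b ℕ.* b′) (a ℕ.* b′ ℕ.+ b ℕ.* a′) ⟩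
          (a ℕ.* a′ ℕ.+ b ℕ.* b′) ×ᵣ 1# - (a ℕ.* b′ ℕ.+ b ℕ.* a′) ×ᵣ 1#             ≈⟨ +-cong (homo a a′ b b′) (-‿cong (homo a b′ b a′)) ⟩
          (a ×ᵣ 1# * (a′ ×ᵣ 1#) + b ×ᵣ 1# * (b′ ×ᵣ 1#)) - (a ×ᵣ 1# * (b′ ×ᵣ 1#) + b ×ᵣ 1# * (a′ ×ᵣ 1#)) ≈⟨ expand _ _ _ _ ⟨
          (a ×ᵣ 1# - b ×ᵣ 1#) * (a′ ×ᵣ 1# - b′ ×ᵣ 1#)                                 ≈⟨ *-cong (difference-≈ a b) (difference-≈ a′ b′) ⟨
          difference (a , b) * difference (a′ , b′)                                 ∎
      ; -‿homo = λ (a , b) → begin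
          difference (b , a)         ≈⟨ difference-≈ b a ⟩
          b ×ᵣ 1# - a ×ᵣ 1#          ≈⟨ +-comm _ _ ⟩
          - (a ×ᵣ 1#) + b ×ᵣ 1#      ≈⟨ +-congˡ (-‿involutive _) ⟨
          - (a ×ᵣ 1#) - - (b ×ᵣ 1#)  ≈⟨ RingProperties.-‿+-comm ring _ _ ⟩
          - (a ×ᵣ 1# - b ×ᵣ 1#)      ≈⟨ -‿cong (difference-≈ a b) ⟨
          - difference (a , b)       ∎
      ; 0-homo = refl
      ; 1-homo = refl
      }
      where
      open SetoidReasoning setoid
      homo : ∀ a a′ b b′ → (a ℕ.* a′ ℕ.+ b ℕ.* b′) ×ᵣ 1# ≈ a ×ᵣ 1# * (a′ ×ᵣ 1#) + b ×ᵣ 1# * (b′ ×ᵣ 1#)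
      homo a a′ b b′ = trans (×-homo-+ 1# (a ℕ.* a′) (b ℕ.* b′)) (+-cong (×1-homo-* a a′) (×1-homo-* b b′))
      expand : ∀ x y z w → (x - y) * (z - w) ≈ (x * z + y * w) - (x * w + y * z)
      expand x y z w = begin
        (x - y) * (z - w)                           ≈⟨ solve 4 (λ x y′ z w′ → (x :+ y′) :* (z :+ w′) := (x :* z :+ y′ :* w′) :+ (x :* w′ :+ y′ :* z)) refl x (- y) z (- w) ⟩
        (x * z + - y * - w) + (x * - w + - y * z)   ≈⟨ +-cong (+-congˡ (trans (sym (-‿distribˡ-* _ _)) (trans (-‿cong (sym (-‿distribʳ-* _ _))) (-‿involutive _)))) (+-cong (sym (-‿distribʳ-* _ _)) (sym (-‿distribˡ-* _ _))) ⟩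
        (x * z + y * w) + (- (x * w) - y * z)       ≈⟨ +-congˡ (RingProperties.-‿+-comm ring _ _) ⟩
        (x * z + y * w) - (x * w + y * z)           ∎

    difference-≟ : ∀ p q → Maybe (difference p ≈ difference q)
    difference-≟ (a , b) (a′ , b′) with a ℕ.+ b′ ℕ.≟ a′ ℕ.+ b
    ... | no  _  = nothing
    ... | yes eq = just (begin
          difference (a , b)      ≈⟨ difference-≈ a b ⟩
          a ×ᵣ 1# - b ×ᵣ 1#       ≈⟨ shuffle _ _ _ _ (trans (sym (×-homo-+ 1# a b′)) (trans (reflexive (≡.cong (_×ᵣ 1#) eq)) (×-homo-+ 1# a′ b))) ⟩
          a′ ×ᵣ 1# - b′ ×ᵣ 1#     ≈⟨ difference-≈ a′ b′ ⟨
          difference (a′ , b′)    ∎)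
      where open SetoidReasoning setoid

    open RingSolver differences (fromCommutativeRing commutativeRing) morphism difference-≟ public

    𝟘 𝟙 : ∀ {n} → Polynomial n
    𝟘 = con (0 , 0)
    𝟙 = con (1 , 0)

  open Solver public using (solve; _:+_; _:*_; _:-_; :-_; _:=_; 𝟘; 𝟙)

  strictTotalOrder : StrictTotalOrder _ _ _
  strictTotalOrder = record { isStrictTotalOrder = isStrictTotalOrder }

  open IsStrictTotalOrder isStrictTotalOrder public
    using (compare; irrefl; <-resp-≈; <-respˡ-≈; <-respʳ-≈) renaming (trans to <-trans)
  open StrictReasoning (StrictTotalOrder.strictPartialOrder strictTotalOrder) public

  private module NonStrict = StrictToNonStrict _≈_ _<_

  <⇒≤ : ∀ {x y} → x < y → x ≤ y
  <⇒≤ = inj₁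

  ≤-reflexive : ∀ {x y} → x ≈ y → x ≤ y
  ≤-reflexive = inj₂

  ≤-refl : ∀ {x} → x ≤ x
  ≤-refl = inj₂ refl

  ≤-trans : ∀ {x y z} → x ≤ y → y ≤ z → x ≤ z
  ≤-trans = NonStrict.trans isEquivalence <-resp-≈ <-trans

  <-≤-trans : ∀ {x y z} → x < y → y ≤ z → x < z
  <-≤-trans = NonStrict.<-≤-trans <-trans <-respʳ-≈

  ≤-<-trans : ∀ {x y z} → x ≤ y → y < z → x < z
  ≤-<-trans = NonStrict.≤-<-trans sym <-trans <-respˡ-≈

  ≤-respˡ-≈ : ∀ {x y z} → x ≈ y → x ≤ z → y ≤ z
  ≤-respˡ-≈ = NonStrict.≤-respˡ-≈ sym trans <-respˡ-≈

  ≤-respʳ-≈ : ∀ {x y z} → x ≈ y → z ≤ x → z ≤ y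
  ≤-respʳ-≈ = NonStrict.≤-respʳ-≈ trans <-respʳ-≈

  ≤-antisym : ∀ {x y} → x ≤ y → y ≤ x → x ≈ y
  ≤-antisym = NonStrict.antisym isEquivalence <-trans irrefl

  <⇒≱ : ∀ {x y} → x < y → ¬ (y ≤ x)
  <⇒≱ x<y y≤x = irrefl refl (<-≤-trans x<y y≤x)

  <-≤-connex : ∀ x y → (x < y) ⊎ (y ≤ x)
  <-≤-connex x y with compare x y
  ... | tri< x<y _ _ = inj₁ x<y
  ... | tri≈ _ x≈y _ = inj₂ (inj₂ (sym x≈y))
  ... | tri> _ _ y<x = inj₂ (inj₁ y<x)

  +-monoʳ-< : ∀ z {x y} → x < y → z + x < z + y
  +-monoʳ-< z x<y = <-respˡ-≈ (+-comm _ z) (<-respʳ-≈ (+-comm _ z) (+-monoˡ-< _ _ z x<y))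

  +-monoˡ-≤ : ∀ z {x y} → x ≤ y → x + z ≤ y + z
  +-monoˡ-≤ z (inj₁ x<y) = inj₁ (+-monoˡ-< _ _ z x<y)
  +-monoˡ-≤ z (inj₂ x≈y) = inj₂ (+-congʳ x≈y)

  +-monoʳ-≤ : ∀ z {x y} → x ≤ y → z + x ≤ z + y
  +-monoʳ-≤ z (inj₁ x<y) = inj₁ (+-monoʳ-< z x<y)
  +-monoʳ-≤ z (inj₂ x≈y) = inj₂ (+-congˡ x≈y)

  +-mono-≤ : ∀ {x y z w} → x ≤ y → z ≤ w → x + z ≤ y + w
  +-mono-≤ x≤y z≤w = ≤-trans (+-monoˡ-≤ _ x≤y) (+-monoʳ-≤ _ z≤w)

  +-mono-<-≤ : ∀ {x y z w} → x < y → z ≤ w → x + z < y + w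
  +-mono-<-≤ x<y z≤w = <-≤-trans (+-monoˡ-< _ _ _ x<y) (+-monoʳ-≤ _ z≤w)

  nonneg+nonneg : ∀ {x y} → 0# ≤ x → 0# ≤ y → 0# ≤ x + y
  nonneg+nonneg 0≤x 0≤y = ≤-respˡ-≈ (+-identityʳ 0#) (+-mono-≤ 0≤x 0≤y)

  pos+nonneg : ∀ {x y} → 0# < x → 0# ≤ y → 0# < x + y
  pos+nonneg 0<x 0≤y = <-respˡ-≈ (+-identityʳ 0#) (+-mono-<-≤ 0<x 0≤y)

  ≤⇒0≤- : ∀ {x y} → x ≤ y → 0# ≤ y - x
  ≤⇒0≤- {x} {y} x≤y = ≤-respˡ-≈ (-‿inverseʳ x) (+-monoˡ-≤ (- x) x≤y)

  0≤-⇒≤ : ∀ {x y} → 0# ≤ y - x → x ≤ y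
  0≤-⇒≤ {x} {y} h = ≤-respˡ-≈ (+-identityˡ x) (≤-respʳ-≈ (solve 2 (λ x y → y :- x :+ x := y) refl x y) (+-monoˡ-≤ x h))

  <⇒0<- : ∀ {x y} → x < y → 0# < y - x
  <⇒0<- {x} {y} x<y = <-respˡ-≈ (-‿inverseʳ x) (+-monoˡ-< _ _ (- x) x<y)

  0<-⇒< : ∀ {x y} → 0# < y - x → x < y
  0<-⇒< {x} {y} h = <-respˡ-≈ (+-identityˡ x) (<-respʳ-≈ (solve 2 (λ x y → y :- x :+ x := y) refl x y) (+-monoˡ-< _ _ x h))

  ≤0⇒0≤- : ∀ {x} → x ≤ 0# → 0# ≤ - x
  ≤0⇒0≤- {x} x≤0 = ≤-respʳ-≈ (+-identityˡ (- x)) (≤⇒0≤- x≤0)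

  0≤-⇒≤0 : ∀ {x} → 0# ≤ - x → x ≤ 0#
  0≤-⇒≤0 {x} h = 0≤-⇒≤ (≤-respʳ-≈ (sym (+-identityˡ (- x))) h)

  nonneg*nonneg : ∀ {x y} → 0# ≤ x → 0# ≤ y → 0# ≤ x * y
  nonneg*nonneg (inj₁ 0<x) (inj₁ 0<y) = inj₁ (*-pos _ _ 0<x 0<y)
  nonneg*nonneg (inj₂ 0≈x) _          = inj₂ (trans (sym (zeroˡ _)) (*-congʳ 0≈x))
  nonneg*nonneg (inj₁ _)   (inj₂ 0≈y) = inj₂ (trans (sym (zeroʳ _)) (*-congˡ 0≈y))

  nonneg*nonpos : ∀ {x y} → 0# ≤ x → y ≤ 0# → x * y ≤ 0#
  nonneg*nonpos 0≤x y≤0 = 0≤-⇒≤0 (≤-respʳ-≈ (sym (-‿distribʳ-* _ _)) (nonneg*nonneg 0≤x (≤0⇒0≤- y≤0)))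

  nonpos*nonneg : ∀ {x y} → x ≤ 0# → 0# ≤ y → x * y ≤ 0#
  nonpos*nonneg x≤0 0≤y = ≤-respˡ-≈ (*-comm _ _) (nonneg*nonpos 0≤y x≤0)

  nonpos*nonpos : ∀ {x y} → x ≤ 0# → y ≤ 0# → 0# ≤ x * y
  nonpos*nonpos {x} {y} x≤0 y≤0 =
    ≤-respʳ-≈ (solve 2 (λ x y → (:- x) :* (:- y) := x :* y) refl x y) (nonneg*nonneg (≤0⇒0≤- x≤0) (≤0⇒0≤- y≤0))

  *-monoˡ-≤ : ∀ {x y z} → 0# ≤ z → x ≤ y → z * x ≤ z * y
  *-monoˡ-≤ {x} {y} {z} 0≤z x≤y =
    0≤-⇒≤ (≤-respʳ-≈ (solve 3 (λ x y z → z :* (y :- x) := z :* y :- z :* x) refl x y z) (nonneg*nonneg 0≤z (≤⇒0≤- x≤y)))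

  0≤square : ∀ x → 0# ≤ x * x
  0≤square x with <-≤-connex 0# x
  ... | inj₁ 0<x = nonneg*nonneg (<⇒≤ 0<x) (<⇒≤ 0<x)
  ... | inj₂ x≤0 = nonpos*nonpos x≤0 x≤0

  0<1 : 0# < 1#
  0<1 with 0≤square 1#
  ... | inj₁ 0<1*1 = <-respʳ-≈ (*-identityˡ 1#) 0<1*1
  ... | inj₂ 0≈1*1 = contradiction (trans 0≈1*1 (*-identityˡ 1#)) 0≉1

  no-zero-divisors : ∀ {x y} → ¬ (x ≈ 0#) → x * y ≈ 0# → y ≈ 0#
  no-zero-divisors {x} {y} x≉0 xy≈0 with invertible x x≉0
  ... | w , xw≈1 = begin-equality
    y            ≈⟨ *-identityˡ y ⟨
    1# * y       ≈⟨ *-congʳ xw≈1 ⟨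
    x * w * y    ≈⟨ solve 3 (λ x w y → x :* w :* y := w :* (x :* y)) refl x w y ⟩
    w * (x * y)  ≈⟨ *-congˡ xy≈0 ⟩
    w * 0#       ≈⟨ zeroʳ w ⟩
    0#           ∎

  pos⇒≉0 : ∀ {x} → 0# < x → ¬ (x ≈ 0#)
  pos⇒≉0 0<x x≈0 = irrefl (sym x≈0) 0<x

  0<square : ∀ {x} → ¬ (x ≈ 0#) → 0# < x * x
  0<square {x} x≉0 with 0≤square x
  ... | inj₁ 0<xx = 0<xx
  ... | inj₂ 0≈xx = contradiction (no-zero-divisors x≉0 (sym 0≈xx)) x≉0

  pos-factor : ∀ {x y} → 0# < x → 0# < x * y → 0# < y
  pos-factor {x} {y} 0<x 0<xy with <-≤-connex 0# y
  ... | inj₁ 0<y = 0<y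
  ... | inj₂ y≤0 = contradiction (nonneg*nonpos (<⇒≤ 0<x) y≤0) (<⇒≱ 0<xy)

  recip : ∀ {x} → 0# < x → Carrier
  recip {x} 0<x = proj₁ (invertible x (pos⇒≉0 0<x))

  *-recip : ∀ {x} (0<x : 0# < x) → x * recip 0<x ≈ 1#
  *-recip {x} 0<x = proj₂ (invertible x (pos⇒≉0 0<x))

  recip-pos : ∀ {x} (0<x : 0# < x) → 0# < recip 0<x
  recip-pos 0<x = pos-factor 0<x (<-respʳ-≈ (sym (*-recip 0<x)) 0<1)

  self-opposite⇒≈0 : ∀ {x} → x ≈ - x → x ≈ 0#
  self-opposite⇒≈0 {x} x≈-x = no-zero-divisors (pos⇒≉0 (pos+nonneg 0<1 (<⇒≤ 0<1))) (begin-equality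
    (1# + 1#) * x  ≈⟨ solve 1 (λ x → (𝟙 :+ 𝟙) :* x := x :+ x) refl x ⟩
    x + x          ≈⟨ +-congˡ x≈-x ⟩
    x - x          ≈⟨ -‿inverseʳ x ⟩
    0#             ∎)

  sum-nonneg : ∀ {n} {f : Fin n → Carrier} → (∀ i → 0# ≤ f i) → 0# ≤ sum f
  sum-nonneg {zero}  0≤f = ≤-refl
  sum-nonneg {suc n} 0≤f = nonneg+nonneg (0≤f zero) (sum-nonneg (λ i → 0≤f (suc i)))

  sum-≥-term : ∀ {n} {f : Fin n → Carrier} → (∀ i → 0# ≤ f i) → ∀ i → f i ≤ sum f
  sum-≥-term 0≤f zero    = ≤-respˡ-≈ (+-identityʳ _) (+-monoʳ-≤ _ (sum-nonneg (λ i → 0≤f (suc i))))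
  sum-≥-term 0≤f (suc i) = ≤-respˡ-≈ (+-identityˡ _) (+-mono-≤ (0≤f zero) (sum-≥-term (λ i → 0≤f (suc i)) i))

  sum-mono-≤ : ∀ {n} {f g : Fin n → Carrier} → (∀ i → f i ≤ g i) → sum f ≤ sum g
  sum-mono-≤ {zero}  f≤g = ≤-refl
  sum-mono-≤ {suc n} f≤g = +-mono-≤ (f≤g zero) (sum-mono-≤ (λ i → f≤g (suc i)))

  sum-≈0 : ∀ {n} {f : Fin n → Carrier} → (∀ i → f i ≈ 0#) → sum f ≈ 0#
  sum-≈0 {n} f≈0 = trans (sum-cong-≋ f≈0) (sum-replicate-zero n)

  sum-neg : ∀ {n} (f : Fin n → Carrier) → sum (λ i → - f i) ≈ - sum f
  sum-neg {zero}  f = sym -0#≈0#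
  sum-neg {suc n} f = trans (+-congˡ (sum-neg (λ i → f (suc i)))) (RingProperties.-‿+-comm ring _ _)

  sum-single : ∀ {n} (k : Fin n) {f : Fin n → Carrier} → (∀ i → i ≢ k → f i ≈ 0#) → sum f ≈ f k
  sum-single zero    f≈0 = trans (+-congˡ (sum-≈0 (λ i → f≈0 (suc i) λ()))) (+-identityʳ _)
  sum-single (suc k) f≈0 = trans (+-cong (f≈0 zero λ()) (sum-single k (λ i i≢k → f≈0 (suc i) (λ where ≡.refl → i≢k ≡.refl)))) (+-identityˡ _)

  sum-minus : ∀ {n} (f g : Fin n → Carrier) → sum (λ i → f i - g i) ≈ sum f - sum g
  sum-minus f g = trans (∑-distrib-+ f (λ i → - g i)) (+-congˡ (sum-neg g))

  pos-left : ∀ {x y} → 0# ≤ y → 0# < x * y → 0# < x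
  pos-left {x} 0≤y 0<xy with <-≤-connex 0# x
  ... | inj₁ 0<x = 0<x
  ... | inj₂ x≤0 = contradiction (nonpos*nonneg x≤0 0≤y) (<⇒≱ 0<xy)

  pos-right : ∀ {x y} → 0# ≤ x → 0# < x * y → 0# < y
  pos-right 0≤x 0<xy = pos-left 0≤x (<-respʳ-≈ (*-comm _ _) 0<xy)

  sum-nonpos : ∀ {n} {f : Fin n → Carrier} → (∀ i → f i ≤ 0#) → sum f ≤ 0#
  sum-nonpos {n} f≤0 = ≤-respʳ-≈ (sum-≈0 {n} λ _ → refl) (sum-mono-≤ f≤0)

  sum-assoc : ∀ {m n} (f : Fin m → Carrier) (B : Fin m → Fin n → Carrier) (g : Fin n → Carrier) →
    (sum λ k → (sum λ j → f j * B j k) * g k) ≈ (sum λ j → f j * (sum λ k → B j k * g k))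
  sum-assoc f B g = begin-equality
    (sum λ k → (sum λ j → f j * B j k) * g k)    ≈⟨ (sum-cong-≋ λ k → *-distribʳ-sum (g k) (λ j → f j * B j k)) ⟩
    (sum λ k → sum λ j → f j * B j k * g k)      ≈⟨ ∑-comm (λ k j → f j * B j k * g k) ⟩
    (sum λ j → sum λ k → f j * B j k * g k)      ≈⟨ (sum-cong-≋ λ j → trans (sum-cong-≋ λ k → *-assoc (f j) (B j k) (g k)) (sym (*-distribˡ-sum (f j) (λ k → B j k * g k)))) ⟩
    (sum λ j → f j * (sum λ k → B j k * g k))    ∎

  pos*neg : ∀ {x y} → 0# < x → y < 0# → x * y < 0#
  pos*neg {x} {y} 0<x y<0 = 0<-⇒< (<-respʳ-≈ (solve 2 (λ x y → x :* (𝟘 :- y) := 𝟘 :- x :* y) refl x y) (*-pos _ _ 0<x (<⇒0<- y<0)))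

-- Determinants, Schur complements and P-matrices

module Determinant {c ℓ₁ ℓ₂} (ℝ : RealNumbers c ℓ₁ ℓ₂) where

  open OrderedField ℝ
  open Real ℝ
  open RawSemiringDefinitions (Semiring.rawSemiring semiring) using (_^_)
  open CommutativeMonoidSum *-commutativeMonoid
    using () renaming (sum to product; sum-remove to product-remove; ∑-distrib-+ to product-*)

  sign : ∀ {n} → Fin n → Carrier
  sign j = (- 1#) ^ toℕ j

  det-cong : ∀ {n} {A B : Square n} → A ≋ B → det A ≈ det B
  det-cong {zero}  A≋B = refl
  det-cong {suc n} A≋B = sum-cong-≋ λ j →
    *-congˡ {sign j} (*-cong (A≋B zero j) (det-cong λ i k → A≋B (suc i) (punchIn j k)))

  det-scaleˡ : ∀ {n} (u : Vec (Fin n)) (A : Square n) → det (λ i j → u i * A i j) ≈ product u * det A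
  det-scaleˡ {zero}  u A = sym (*-identityˡ 1#)
  det-scaleˡ {suc n} u A = begin-equality
    (sum λ j → sign j * (u zero * A zero j * det (λ i k → u (suc i) * A (suc i) (punchIn j k))))
      ≈⟨ sum-cong-≋ (λ j → trans
           (*-congˡ {sign j} (*-congˡ (det-scaleˡ (u ∘ suc) (λ i k → A (suc i) (punchIn j k)))))
           (solve 5 (λ s u a p d → s :* (u :* a :* (p :* d)) := (u :* p) :* (s :* (a :* d))) refl (sign j) (u zero) (A zero j) (product (u ∘ suc)) _)) ⟩
    (sum λ j → product u * (sign j * (A zero j * det (λ i k → A (suc i) (punchIn j k)))))
      ≈⟨ *-distribˡ-sum (product u) (λ j → sign j * (A zero j * det (λ i k → A (suc i) (punchIn j k)))) ⟨
    product u * det A ∎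

  det-scaleʳ : ∀ {n} (v : Vec (Fin n)) (A : Square n) → det (λ i j → A i j * v j) ≈ product v * det A
  det-scaleʳ {zero}  v A = sym (*-identityˡ 1#)
  det-scaleʳ {suc n} v A = begin-equality
    (sum λ j → sign j * (A zero j * v j * det (λ i k → A (suc i) (punchIn j k) * v (punchIn j k))))
      ≈⟨ sum-cong-≋ (λ j → trans
           (*-congˡ {sign j} (*-congˡ (det-scaleʳ (v ∘ punchIn j) (λ i k → A (suc i) (punchIn j k)))))
           (trans (solve 5 (λ s u a p d → s :* (a :* u :* (p :* d)) := (u :* p) :* (s :* (a :* d))) refl (sign j) (v j) (A zero j) (product (v ∘ punchIn j)) _)
                  (*-congʳ (sym (product-remove {i = j} v))))) ⟩
    (sum λ j → product v * (sign j * (A zero j * det (λ i k → A (suc i) (punchIn j k)))))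
      ≈⟨ *-distribˡ-sum (product v) (λ j → sign j * (A zero j * det (λ i k → A (suc i) (punchIn j k)))) ⟨
    product v * det A ∎

  product-pos : ∀ {n} {u : Vec (Fin n)} → (∀ i → 0# < u i) → 0# < product u
  product-pos {zero}  0<u = 0<1
  product-pos {suc n} 0<u = *-pos _ _ (0<u zero) (product-pos (λ i → 0<u (suc i)))

  -- A principal submatrix keeps the same indices for rows and columns, so its determinant picks up
  -- the product of the `u i * v i`. Asking positivity of these products covers both positive
  -- scalings and conjugation by a signature matrix.
  IsP-scale : ∀ {n} {A B : Square n} (u v : Vec (Fin n)) → (∀ i → 0# < u i * v i) →
              (∀ i j → B i j ≈ u i * A i j * v j) → IsP A → IsP B
  IsP-scale {A = A} {B} u v 0<uv B≋uAv A-P k α α-mono = <-respʳ-≈ (sym detB) (*-pos _ _ (product-pos (λ i → 0<uv (α i))) (A-P k α α-mono))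
    where
    detB : det (λ i j → B (α i) (α j)) ≈ product (λ i → u (α i) * v (α i)) * det (λ i j → A (α i) (α j))
    detB = begin-equality
      det (λ i j → B (α i) (α j))                          ≈⟨ det-cong (λ i j → B≋uAv (α i) (α j)) ⟩
      det (λ i j → u (α i) * A (α i) (α j) * v (α j))      ≈⟨ det-scaleʳ (v ∘ α) (λ i j → u (α i) * A (α i) (α j)) ⟩
      product (v ∘ α) * det (λ i j → u (α i) * A (α i) (α j)) ≈⟨ *-congˡ (det-scaleˡ (u ∘ α) (λ i j → A (α i) (α j))) ⟩
      product (v ∘ α) * (product (u ∘ α) * det (λ i j → A (α i) (α j))) ≈⟨ solve 3 (λ x y z → x :* (y :* z) := (y :* x) :* z) refl (product (v ∘ α)) (product (u ∘ α)) _ ⟩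
      product (u ∘ α) * product (v ∘ α) * det (λ i j → A (α i) (α j))    ≈⟨ *-congʳ (product-* (u ∘ α) (v ∘ α)) ⟨
      product (λ i → u (α i) * v (α i)) * det (λ i j → A (α i) (α j)) ∎

  -- The sum over ordered pairs (p , q) of distinct columns, q = punchIn p l.

  pairSum : ∀ {n} (f g : Vec (Fin (suc (suc n)))) (F : (Fin n → Fin (suc (suc n))) → Carrier) → Carrier
  pairSum f g F = sum λ k → sum λ l → sign k * sign l * (f k * g (punchIn k l) * F (punchIn k ∘ punchIn l))

  lift : ∀ {m n} → (Fin m → Fin n) → Fin (suc m) → Fin (suc n)
  lift φ zero    = zero
  lift φ (suc i) = suc (φ i)

  Congruent : ∀ {m n} → ((Fin m → Fin n) → Carrier) → Set ℓ₁
  Congruent F = ∀ φ ψ → (∀ i → φ i ≡ ψ i) → F φ ≈ F ψ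

  restSum : ∀ {n} (f g : Vec (Fin (suc (suc n)))) (F : (Fin n → Fin (suc (suc n))) → Carrier) → Carrier
  restSum f g F = sum λ k → sum λ l → sign (suc k) * sign (suc l) * (f (suc k) * g (suc (punchIn k l)) * F (punchIn (suc k) ∘ punchIn (suc l)))

  rowSum : ∀ {n} (f g : Vec (Fin (suc (suc n)))) (F : (Fin n → Fin (suc (suc n))) → Carrier) → Carrier
  rowSum f g F = sum λ l → sign l * (f zero * g (suc l) * F (suc ∘ punchIn l))

  -- The pairs are sorted by whether column zero comes first, second or not at all. In second place
  -- it costs the factor -1 by which `sign (suc k)` differs from `sign k`.
  pairSum-split : ∀ {n} (f g : Vec (Fin (suc (suc n)))) F →
    pairSum f g F ≈ rowSum f g F - rowSum g f F + restSum f g F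
  pairSum-split {n} f g F = begin-equality
    (sum λ l → 1# * sign l * (f zero * g (suc l) * F (suc ∘ punchIn l)))
      + (sum λ k → - 1# * sign k * 1# * (f (suc k) * g zero * F (suc ∘ punchIn k))
          + (sum λ l → sign (suc k) * sign (suc l) * (f (suc k) * g (suc (punchIn k l)) * F (punchIn (suc k) ∘ punchIn (suc l)))))
      ≈⟨ +-cong (sum-cong-≋ {suc n} λ l → *-congʳ {f zero * g (suc l) * F (suc ∘ punchIn l)} (*-identityˡ (sign l)))
                (trans (∑-distrib-+ {suc n} (λ k → - 1# * sign k * 1# * (f (suc k) * g zero * F (suc ∘ punchIn k))) (λ k → sum {n} λ l → sign (suc k) * sign (suc l) * (f (suc k) * g (suc (punchIn k l)) * F (punchIn (suc k) ∘ punchIn (suc l)))))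
                       (+-congʳ (trans (sum-cong-≋ {suc n} λ k →
                            solve 4 (λ s f g h → (:- 𝟙 :* s :* 𝟙) :* (f :* g :* h) := :- (s :* (g :* f :* h))) refl (sign k) (f (suc k)) (g zero) (F (suc ∘ punchIn k)))
                          (sum-neg {suc n} λ k → sign k * (g zero * f (suc k) * F (suc ∘ punchIn k)))))) ⟩
    rowSum f g F + (- rowSum g f F + restSum f g F)  ≈⟨ +-assoc _ _ _ ⟨
    rowSum f g F - rowSum g f F + restSum f g F      ∎

  -- Swapping the columns of a pair shifts one position by one place, which changes the sign, and
  -- leaves the remaining columns the same. Induction avoids expressing the swap through `punchIn`:
  -- pairs with column zero are exchanged by `pairSum-split`, and the others form a sum of the same
  -- kind with one column fewer.
  pairSum-antisym : ∀ {n} (f g : Vec (Fin (suc (suc n)))) {F} → Congruent F → pairSum f g F ≈ - pairSum g f F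
  restSum-antisym : ∀ {n} (f g : Vec (Fin (suc (suc n)))) {F} → Congruent F → restSum f g F ≈ - restSum g f F

  pairSum-antisym f g {F} F-cong = begin-equality
    pairSum f g F                                      ≈⟨ pairSum-split f g F ⟩
    rowSum f g F - rowSum g f F + restSum f g F        ≈⟨ +-congˡ (restSum-antisym f g F-cong) ⟩
    rowSum f g F - rowSum g f F - restSum g f F        ≈⟨ solve 3 (λ x y z → x :- y :- z := :- (y :- x :+ z)) refl (rowSum f g F) (rowSum g f F) (restSum g f F) ⟩
    - (rowSum g f F - rowSum f g F + restSum g f F)    ≈⟨ -‿cong (pairSum-split g f F) ⟨
    - pairSum g f F                                    ∎

  restSum-antisym {zero}  f g F-cong = sym (solve 0 (:- (𝟘 :+ 𝟘) := 𝟘 :+ 𝟘) refl)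
  restSum-antisym {suc n} f g {F} F-cong = begin-equality
    restSum f g F                                    ≈⟨ rest≈pair f g ⟩
    pairSum (f ∘ suc) (g ∘ suc) (F ∘ lift)           ≈⟨ pairSum-antisym (f ∘ suc) (g ∘ suc) (λ φ ψ eq → F-cong (lift φ) (lift ψ) λ { zero → ≡.refl ; (suc i) → ≡.cong suc (eq i) }) ⟩
    - pairSum (g ∘ suc) (f ∘ suc) (F ∘ lift)         ≈⟨ -‿cong (rest≈pair g f) ⟨
    - restSum g f F                                  ∎
    where
    rest≈pair : ∀ f g → restSum f g F ≈ pairSum (f ∘ suc) (g ∘ suc) (F ∘ lift)
    rest≈pair f g = sum-cong-≋ {suc (suc n)} λ k → sum-cong-≋ {suc n} λ l → *-cong
      (solve 2 (λ s t → (:- 𝟙 :* s) :* (:- 𝟙 :* t) := s :* t) refl (sign k) (sign l))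
      (*-congˡ {f (suc k) * g (suc (punchIn k l))} (F-cong (punchIn (suc k) ∘ punchIn (suc l)) (lift (punchIn k ∘ punchIn l)) λ { zero → ≡.refl ; (suc i) → ≡.refl }))

  -- The corner 1 allows elimination without division: subtracting multiples of the first row leaves
  -- A minus the product of the column s and the row r.
  border : ∀ {n} (r s : Vec (Fin n)) (A : Square n) → Square (suc n)
  border r s A zero    zero    = 1#
  border r s A zero    (suc j) = r j
  border r s A (suc i) zero    = s i
  border r s A (suc i) (suc j) = A i j

  prependColumn : ∀ {n} → Vec (Fin (suc n)) → Matrix (Fin (suc n)) (Fin n) → Square (suc n)
  prependColumn s A i zero    = s i
  prependColumn s A i (suc j) = A i j

  det-prependColumn-cong : ∀ {n} (s : Vec (Fin (suc n))) {A B : Matrix (Fin (suc n)) (Fin n)} → A ≋ B →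
                           det (prependColumn s A) ≈ det (prependColumn s B)
  det-prependColumn-cong {n} s {A} {B} A≋B = det-cong {suc n} {prependColumn s A} {prependColumn s B} λ { i zero → refl ; i (suc j) → A≋B i j }

  det-border-expand : ∀ {n} (r s : Vec (Fin (suc n))) (A : Square (suc n)) →
    det (border r s A) ≈ det A - (sum λ k → sign k * (r k * det (prependColumn s λ i j → A i (punchIn k j))))
  det-border-expand {n} r s A = +-cong
    (solve 1 (λ x → 𝟙 :* (𝟙 :* x) := x) refl (det A))
    (trans (sum-cong-≋ {suc n} λ k → trans
              (*-congˡ { - 1# * sign k} (*-congˡ {r k} (det-cong (minor k))))
              (solve 2 (λ s x → :- 𝟙 :* s :* x := :- (s :* x)) refl (sign k) _))
           (sum-neg {suc n} λ k → sign k * (r k * det (prependColumn s λ i j → A i (punchIn k j)))))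
    where
    minor : ∀ k → (λ i j → border r s A (suc i) (punchIn (suc k) j)) ≋ prependColumn s (λ i j → A i (punchIn k j))
    minor k i zero    = refl
    minor k i (suc j) = refl

  det-prependColumn-expand : ∀ {n} (s : Vec (Fin (suc (suc n)))) (A : Matrix (Fin (suc (suc n))) (Fin (suc n))) →
    det (prependColumn s A) ≈ s zero * det (λ i j → A (suc i) j)
      - (sum λ l → sign l * (A zero l * det (prependColumn (s ∘ suc) λ i j → A (suc i) (punchIn l j))))
  det-prependColumn-expand {n} s A = +-cong
    (*-identityˡ _)
    (trans (sum-cong-≋ {suc n} λ l → trans
              (*-congˡ { - 1# * sign l} (*-congˡ {A zero l} (det-cong (minor l))))
              (solve 2 (λ s x → :- 𝟙 :* s :* x := :- (s :* x)) refl (sign l) _))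
           (sum-neg {suc n} λ l → sign l * (A zero l * det (prependColumn (s ∘ suc) λ i j → A (suc i) (punchIn l j)))))
    where
    minor : ∀ l → (λ i j → prependColumn s A (suc i) (punchIn (suc l) j)) ≋ prependColumn (s ∘ suc) (λ i j → A (suc i) (punchIn l j))
    minor l i zero    = refl
    minor l i (suc j) = refl

  pairSum-linearˡ : ∀ {n} (f g h : Vec (Fin (suc (suc n)))) x F →
    pairSum (λ k → f k - x * g k) h F ≈ pairSum f h F - x * pairSum g h F
  pairSum-linearˡ {n} f g h x F = begin-equality
    pairSum (λ k → f k - x * g k) h F
      ≈⟨ (sum-cong-≋ {suc (suc n)} λ k → trans
           (sum-cong-≋ {suc n} λ l → solve 6 (λ σ f x g h φ → σ :* ((f :- x :* g) :* h :* φ) := σ :* (f :* h :* φ) :- x :* (σ :* (g :* h :* φ)))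
              refl (sign k * sign l) (f k) x (g k) (h (punchIn k l)) (F (punchIn k ∘ punchIn l)))
           (trans (sum-minus (t f k) (λ l → x * t g k l)) (+-congˡ (-‿cong (sym (*-distribˡ-sum x (t g k))))))) ⟩
    sum (λ k → sum (t f k) - x * sum (t g k))
      ≈⟨ sum-minus (λ k → sum (t f k)) (λ k → x * sum (t g k)) ⟩
    pairSum f h F - sum (λ k → x * sum (t g k))
      ≈⟨ +-congˡ (-‿cong (sym (*-distribˡ-sum x (λ k → sum (t g k))))) ⟩
    pairSum f h F - x * pairSum g h F  ∎
    where
    t : Vec (Fin (suc (suc n))) → Fin (suc (suc n)) → Fin (suc n) → Carrier
    t f k l = sign k * sign l * (f k * h (punchIn k l) * F (punchIn k ∘ punchIn l))

  scale-minus-sum : ∀ {n} (σ x d : Carrier) (τ a φ : Vec (Fin n)) →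
    σ * (x * (d - sum λ l → τ l * (a l * φ l))) ≈ σ * (x * d) - sum λ l → σ * τ l * (x * a l * φ l)
  scale-minus-sum σ x d τ a φ = begin-equality
    σ * (x * (d - sum t))                  ≈⟨ solve 4 (λ σ x d t → σ :* (x :* (d :- t)) := σ :* (x :* d) :- σ :* x :* t) refl σ x d (sum t) ⟩
    σ * (x * d) - σ * x * sum t            ≈⟨ +-congˡ (-‿cong (trans (*-distribˡ-sum (σ * x) t) (sum-cong-≋ λ l →
                                                solve 5 (λ σ x τ a φ → σ :* x :* (τ :* (a :* φ)) := σ :* τ :* (x :* a :* φ)) refl σ x (τ l) (a l) (φ l)))) ⟩
    σ * (x * d) - sum (λ l → σ * τ l * (x * a l * φ l)) ∎
    where t = λ l → τ l * (a l * φ l)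

  -- Expanding along the first two rows leaves double sums over pairs of columns,
  -- which agree by pairSum-antisym.

  det-border : ∀ {n} (r s : Vec (Fin n)) (A : Square n) → det (border r s A) ≈ det (λ i j → A i j - s i * r j)
  det-border {zero}         r s A = solve 0 (𝟙 :* (𝟙 :* 𝟙) :+ 𝟘 := 𝟙) refl
  det-border {suc zero}     r s A = solve 3 (λ r s a →
    𝟙 :* (𝟙 :* (𝟙 :* (a :* 𝟙) :+ 𝟘)) :+ ((:- 𝟙 :* 𝟙) :* (r :* (𝟙 :* (s :* 𝟙) :+ 𝟘)) :+ 𝟘)
      := 𝟙 :* ((a :- s :* r) :* 𝟙) :+ 𝟘) refl (r zero) (s zero) (A zero zero)
  det-border {suc (suc n)} r s A = begin-equality
    det (border r s A)
      ≈⟨ det-border-expand r s A ⟩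
    det A - (sum λ k → sign k * (r k * det (prependColumn s λ i j → A i (punchIn k j))))
      ≈⟨ +-congˡ {det A} (-‿cong (trans (sum-cong-≋ {suc (suc n)} λ k → trans
           (*-congˡ {sign k} (*-congˡ {r k} (det-prependColumn-expand s λ i j → A i (punchIn k j))))
           (scale-minus-sum (sign k) (r k) (s zero * D k) sign (λ l → A zero (punchIn k l)) (λ l → F (punchIn k ∘ punchIn l))))
           (sum-minus (λ k → sign k * (r k * (s zero * D k))) (pairs r (A zero))))) ⟩
    det A - (S - pairSum r (A zero) F)
      ≈⟨ +-congˡ {det A} (-‿cong (+-congˡ {S} (-‿cong (pairSum-antisym r (A zero) F-cong)))) ⟩
    det A - (S - - pairSum (A zero) r F)
      -- The inserted `s zero * 0#` anticipates `s zero * pairSum r r F`, the term quadratic in r;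
      -- it vanishes because an antisymmetric sum at equal arguments is its own opposite.
      ≈⟨ solve 4 (λ x y z t → x :- (y :- :- z) := (x :- y) :- (z :- t :* 𝟘)) refl (det A) S (pairSum (A zero) r F) (s zero) ⟩
    (det A - S) - (pairSum (A zero) r F - s zero * 0#)
      ≈⟨ +-cong (trans (sum-cong-≋ {suc (suc n)} λ k → expand (sign k) (A zero k) (s zero) (r k) (D k))
                       (sum-minus (λ k → sign k * (A zero k * D k)) (λ k → sign k * (r k * (s zero * D k)))))
                (-‿cong (trans (pairSum-linearˡ (A zero) r r (s zero) F)
                   (+-congˡ (-‿cong (*-congˡ (self-opposite⇒≈0 (pairSum-antisym r r F-cong))))))) ⟨
    (sum λ k → sign k * (a k * D k)) - pairSum a r F
      -- Each minor along the first row of the updated matrix is again a rank-one update; by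
      -- induction it is a bordered determinant, whose expansion produces the pairs of columns.
      ≈⟨ (trans (sum-cong-≋ {suc (suc n)} λ k → trans
           (*-congˡ {sign k} (*-congˡ {a k} (trans
             (sym (det-border (r ∘ punchIn k) (s ∘ suc) λ i j → A (suc i) (punchIn k j)))
             (det-border-expand (r ∘ punchIn k) (s ∘ suc) λ i j → A (suc i) (punchIn k j)))))
           (scale-minus-sum (sign k) (a k) (D k) sign (r ∘ punchIn k) (λ l → F (punchIn k ∘ punchIn l))))
           (sum-minus (λ k → sign k * (a k * D k)) (pairs a r))) ⟨
    det (λ i j → A i j - s i * r j) ∎
    where
    D : Fin (suc (suc n)) → Carrier
    D k = det λ i j → A (suc i) (punchIn k j)
    a : Fin (suc (suc n)) → Carrier
    a k = A zero k - s zero * r k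
    S : Carrier
    S = sum λ k → sign k * (r k * (s zero * D k))
    F : (Fin n → Fin (suc (suc n))) → Carrier
    F φ = det (prependColumn (s ∘ suc) λ i j → A (suc i) (φ j))
    F-cong : Congruent F
    F-cong φ ψ eq = det-prependColumn-cong (s ∘ suc) λ i j → reflexive (≡.cong (A (suc i)) (eq j))
    pairs : ∀ (f g : Fin (suc (suc n)) → Carrier) → Fin (suc (suc n)) → Carrier
    pairs f g k = sum λ l → sign k * sign l * (f k * g (punchIn k l) * F (punchIn k ∘ punchIn l))
    expand : ∀ σ a s r d → σ * ((a - s * r) * d) ≈ σ * (a * d) - σ * (r * (s * d))
    expand = solve 5 (λ σ a s r d → σ :* ((a :- s :* r) :* d) := σ :* (a :* d) :- σ :* (r :* (s :* d))) refl

  -- The reciprocal w of the pivot is an argument, which lets one formula serve the matrix with a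
  -- changed corner and the transpose.
  schur : ∀ {n} → Square (suc n) → Carrier → Square n
  schur A w i j = A (suc i) (suc j) - A (suc i) zero * (w * A zero (suc j))

  -- Factoring the pivot out of the first row leaves a bordered matrix with corner 1, to which
  -- `det-border` applies.
  det-schur : ∀ {n} (A : Square (suc n)) w → A zero zero * w ≈ 1# → det A ≈ A zero zero * det (schur A w)
  det-schur {n} A w aw≈1 = begin-equality
    det A
      ≈⟨ (sum-cong-≋ {suc n} λ j → trans
           (*-congˡ {sign j} (*-cong (row j) (det-cong (minor j))))
           (solve 4 (λ σ a b d → σ :* (a :* b :* d) := a :* (σ :* (b :* d))) refl (sign j) (A zero zero) (B zero j) _)) ⟩
    (sum λ j → A zero zero * (sign j * (B zero j * det λ i k → B (suc i) (punchIn j k))))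
      ≈⟨ *-distribˡ-sum (A zero zero) (λ j → sign j * (B zero j * det λ i k → B (suc i) (punchIn j k))) ⟨
    A zero zero * det B
      ≈⟨ *-congˡ (det-border (λ j → w * A zero (suc j)) (λ i → A (suc i) zero) λ i j → A (suc i) (suc j)) ⟩
    A zero zero * det (schur A w) ∎
    where
    B : Square (suc n)
    B = border (λ j → w * A zero (suc j)) (λ i → A (suc i) zero) (λ i j → A (suc i) (suc j))
    row : ∀ j → A zero j ≈ A zero zero * B zero j
    row zero    = sym (*-identityʳ _)
    row (suc j) = sym (trans (sym (*-assoc _ _ _)) (trans (*-congʳ aw≈1) (*-identityˡ _)))
    tailRows : ∀ i j → A (suc i) j ≈ B (suc i) j
    tailRows i zero    = refl
    tailRows i (suc j) = refl
    minor : ∀ j → (λ i k → A (suc i) (punchIn j k)) ≋ (λ i k → B (suc i) (punchIn j k))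
    minor j i k = tailRows i (punchIn j k)

  schur-·ᵛ : ∀ {n} (A : Square (suc n)) w x i → (schur A w ·ᵛ x) i ≈
    (sum λ j → A (suc i) (suc j) * x j) - A (suc i) zero * w * (sum λ j → A zero (suc j) * x j)
  schur-·ᵛ A w x i = begin-equality
    (schur A w ·ᵛ x) i
      ≈⟨ (sum-cong-≋ λ j → solve 5 (λ b s w r z → (b :- s :* (w :* r)) :* z := b :* z :- s :* w :* (r :* z)) refl
           (A (suc i) (suc j)) (A (suc i) zero) w (A zero (suc j)) (x j)) ⟩
    (sum λ j → A (suc i) (suc j) * x j - A (suc i) zero * w * (A zero (suc j) * x j))
      ≈⟨ sum-minus (λ j → A (suc i) (suc j) * x j) (λ j → A (suc i) zero * w * (A zero (suc j) * x j)) ⟩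
    (sum λ j → A (suc i) (suc j) * x j) - (sum λ j → A (suc i) zero * w * (A zero (suc j) * x j))
      ≈⟨ +-congˡ (-‿cong (sym (*-distribˡ-sum (A (suc i) zero * w) (λ j → A zero (suc j) * x j)))) ⟩
    (sum λ j → A (suc i) (suc j) * x j) - A (suc i) zero * w * (sum λ j → A zero (suc j) * x j) ∎

  IsP-tail : ∀ {n} (A : Square (suc n)) → IsP A → IsP (λ i j → A (suc i) (suc j))
  IsP-tail A A-P k α α-mono = A-P k (suc ∘ α) (λ i<j → ℕ.s<s (α-mono i<j))

  addCorner : ∀ {n} → Carrier → Square (suc n) → Square (suc n)
  addCorner d A zero zero    = A zero zero + d
  addCorner d A zero (suc j) = A zero (suc j)
  addCorner d A (suc i) j    = A (suc i) j

  det-addCorner : ∀ {n} d (A : Square (suc n)) →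
    det (addCorner d A) ≈ det A + d * det (λ i j → A (suc i) (suc j))
  det-addCorner d A = solve 4 (λ a d m r → 𝟙 :* ((a :+ d) :* m) :+ r := 𝟙 :* (a :* m) :+ r :+ d :* m) refl
    (A zero zero) d (det λ i j → A (suc i) (suc j)) _

  IsP⇒0<corner : ∀ {n} (A : Square (suc n)) → IsP A → 0# < A zero zero
  IsP⇒0<corner A A-P = <-respʳ-≈ (solve 1 (λ a → 𝟙 :* (a :* 𝟙) :+ 𝟘 := a) refl (A zero zero))
    (A-P 1 (λ _ → zero) (λ { {zero} {zero} () }))

  -- Times the positive pivot, a principal minor of the Schur complement is a principal minor of the
  -- enlarged matrix through the first index. Raising the corner by d adds d times a principal minor
  -- of A to it, so it stays positive.
  IsP-schur : ∀ {n} (A : Square (suc n)) → IsP A → ∀ {d w} → 0# ≤ d → (A zero zero + d) * w ≈ 1# →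
              IsP (schur (addCorner d A) w)
  IsP-schur {n} A A-P {d} {w} 0≤d aw≈1 k α α-mono =
    pos-factor (pos+nonneg (IsP⇒0<corner A A-P) 0≤d) (<-respʳ-≈ (det-schur A′ w aw≈1) (<-respʳ-≈ (sym detA′)
      (pos+nonneg (A-P (suc k) α⁺ α⁺-mono) (nonneg*nonneg 0≤d (<⇒≤ (IsP-tail A A-P k α α-mono))))))
    where
    α⁺ : Fin (suc k) → Fin (suc n)
    α⁺ = lift α
    α⁺-mono : α⁺ Preserves Fin._<_ ⟶ Fin._<_
    α⁺-mono {zero}  {suc j} _           = ℕ.z<s
    α⁺-mono {suc i} {suc j} (ℕ.s≤s i<j) = ℕ.s<s (α-mono i<j)
    A′ : Square (suc k)
    A′ i j = addCorner d A (α⁺ i) (α⁺ j)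
    A′≋ : A′ ≋ addCorner d (λ i j → A (α⁺ i) (α⁺ j))
    A′≋ zero    zero    = refl
    A′≋ zero    (suc j) = refl
    A′≋ (suc i) j       = refl
    detA′ : det A′ ≈ det (λ i j → A (α⁺ i) (α⁺ j)) + d * det (λ i j → A (suc (α i)) (suc (α j)))
    detA′ = trans (det-cong A′≋) (det-addCorner d (λ i j → A (α⁺ i) (α⁺ j)))

  -- A vector z ≉ 0 whose sign A reverses would, after enlarging the first
  -- diagonal entry so that (A z)₀ ≈ 0, give such a vector for the Schur complement.

  IsP⇒no-sign-reversal : ∀ {n} (A : Square n) → IsP A → ∀ z → (∀ i → z i * (A ·ᵛ z) i ≤ 0#) → ∀ i → z i ≈ 0#
  IsP⇒no-sign-reversal {suc n} A A-P z z*Az≤0 = by-cases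
    where
    y : Fin (suc n) → Carrier
    y = A ·ᵛ z
    tailSum : Fin (suc n) → Carrier
    tailSum i = sum λ j → A i (suc j) * z (suc j)

    impossible : ¬ (z zero ≈ 0#) → ⊥
    impossible z₀≉0 = <⇒≱ (*-pos _ _ (IsP⇒0<corner A A-P) (0<square z₀≉0)) (≤-respˡ-≈ z₀y₀ (z*Az≤0 zero))
      where
      v d a′ w : Carrier
      v = proj₁ (invertible (z zero) z₀≉0)
      -- As v is the reciprocal of `z zero`, adding `d * z zero` cancels `y zero`. This d equals -
      -- v² (`z zero * y zero`), which is nonnegative because A reverses the sign of z.
      d = - (y zero * v)
      z₀v≈1 : z zero * v ≈ 1#
      z₀v≈1 = proj₂ (invertible (z zero) z₀≉0)
      0≤d : 0# ≤ d
      0≤d = ≤0⇒0≤- (begin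
        y zero * v                     ≈⟨ solve 2 (λ y v → y :* v := y :* v :* 𝟙) refl (y zero) v ⟩
        y zero * v * 1#                ≈⟨ *-congˡ z₀v≈1 ⟨
        y zero * v * (z zero * v)      ≈⟨ solve 3 (λ y v z → y :* v :* (z :* v) := v :* v :* (z :* y)) refl (y zero) v (z zero) ⟩
        v * v * (z zero * y zero)      ≤⟨ nonneg*nonpos (0≤square v) (z*Az≤0 zero) ⟩
        0#                             ∎)
      0<a′ : 0# < A zero zero + d
      0<a′ = pos+nonneg (IsP⇒0<corner A A-P) 0≤d
      a′ = A zero zero + d
      w = recip 0<a′
      a′z₀+tail≈0 : a′ * z zero + tailSum zero ≈ 0#
      a′z₀+tail≈0 = begin-equality
        a′ * z zero + tailSum zero          ≈⟨ solve 5 (λ a y v z t → (a :- y :* v) :* z :+ t := (a :* z :+ t) :- y :* (z :* v)) refl (A zero zero) (y zero) v (z zero) (tailSum zero) ⟩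
        y zero - y zero * (z zero * v)      ≈⟨ +-congˡ (-‿cong (trans (*-congˡ z₀v≈1) (*-identityʳ _))) ⟩
        y zero - y zero                     ≈⟨ -‿inverseʳ _ ⟩
        0#                                  ∎
      C : Square n
      C = schur (addCorner d A) w
      Cz≈y : ∀ i → (C ·ᵛ (z ∘ suc)) i ≈ y (suc i)
      Cz≈y i = begin-equality
        (C ·ᵛ (z ∘ suc)) i
          ≈⟨ schur-·ᵛ (addCorner d A) w (z ∘ suc) i ⟩
        tailSum (suc i) - A (suc i) zero * w * tailSum zero
          ≈⟨ solve 6 (λ t s w r a z → t :- s :* w :* r := (s :* (a :* w) :* z :+ t) :- s :* w :* (a :* z :+ r)) refl
               (tailSum (suc i)) (A (suc i) zero) w (tailSum zero) a′ (z zero) ⟩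
        (A (suc i) zero * (a′ * w) * z zero + tailSum (suc i)) - A (suc i) zero * w * (a′ * z zero + tailSum zero)
          ≈⟨ +-cong (+-congʳ (*-congʳ (trans (*-congˡ (*-recip 0<a′)) (*-identityʳ _))))
                    (trans (-‿cong (trans (*-congˡ a′z₀+tail≈0) (zeroʳ _))) -0#≈0#) ⟩
        y (suc i) + 0#  ≈⟨ +-identityʳ _ ⟩
        y (suc i)       ∎
      -- With the first entry of the product cancelled, elimination leaves the other entries of A z
      -- unchanged, so the Schur complement reverses the tail of z. Once the tail vanishes,
      -- `z zero * y zero` is a positive multiple of a square, against the assumption.
      tail≈0 : ∀ i → z (suc i) ≈ 0#
      tail≈0 = IsP⇒no-sign-reversal C (IsP-schur A A-P 0≤d (*-recip 0<a′)) (z ∘ suc) λ i →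
        ≤-respˡ-≈ (*-congˡ (sym (Cz≈y i))) (z*Az≤0 (suc i))
      z₀y₀ : z zero * y zero ≈ A zero zero * (z zero * z zero)
      z₀y₀ = begin-equality
        z zero * (A zero zero * z zero + tailSum zero)
          ≈⟨ *-congˡ (+-congˡ (sum-≈0 λ j → trans (*-congˡ {A zero (suc j)} (tail≈0 j)) (zeroʳ _))) ⟩
        z zero * (A zero zero * z zero + 0#)   ≈⟨ solve 2 (λ z a → z :* (a :* z :+ 𝟘) := a :* (z :* z)) refl (z zero) (A zero zero) ⟩
        A zero zero * (z zero * z zero)        ∎

    by-cases : ∀ i → z i ≈ 0#
    by-cases with compare (z zero) 0#
    ... | tri< _ z₀≉0 _ = ⊥-elim (impossible z₀≉0)
    ... | tri> _ z₀≉0 _ = ⊥-elim (impossible z₀≉0)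
    ... | tri≈ _ z₀≈0 _ = λ { zero → z₀≈0 ; (suc i) → tail≈0 i }
      where
      tail≈0 : ∀ i → z (suc i) ≈ 0#
      tail≈0 = IsP⇒no-sign-reversal (λ i j → A (suc i) (suc j)) (IsP-tail A A-P) (z ∘ suc) λ i →
        ≤-respˡ-≈ (*-congˡ (trans (+-congʳ {tailSum (suc i)} (trans (*-congˡ z₀≈0) (zeroʳ _))) (+-identityˡ _))) (z*Az≤0 (suc i))

-- K-matrices as semipositive Z-matrices

module ZMatrix {c ℓ₁ ℓ₂} (ℝ : RealNumbers c ℓ₁ ℓ₂) where

  open OrderedField ℝ
  open Real ℝ
  open Determinant ℝ using (schur; schur-·ᵛ)

  Id-diagonal : ∀ {n} (j : Fin n) → Id j j ≈ 1#
  Id-diagonal j with j Fin.≟ j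
  ... | yes _   = refl
  ... | no  j≢j = contradiction ≡.refl j≢j

  Id-offDiagonal : ∀ {n} {j l : Fin n} → j ≢ l → Id j l ≈ 0#
  Id-offDiagonal {j = j} {l} j≢l with j Fin.≟ l
  ... | yes j≡l = contradiction j≡l j≢l
  ... | no  _   = refl

  0≤Id : ∀ {n} (j l : Fin n) → 0# ≤ Id j l
  0≤Id j l with j Fin.≟ l
  ... | yes _ = <⇒≤ 0<1
  ... | no  _ = ≤-refl

  sum-*Id : ∀ {n} (x : Vec (Fin n)) k → (sum λ j → x j * Id j k) ≈ x k
  sum-*Id x k = trans (sum-single k (λ j j≢k → trans (*-congˡ (Id-offDiagonal j≢k)) (zeroʳ _)))
                      (trans (*-congˡ (Id-diagonal k)) (*-identityʳ _))

  sum-Id* : ∀ {n} (x : Vec (Fin n)) k → (sum λ j → Id k j * x j) ≈ x k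
  sum-Id* x k = trans (sum-single k (λ j j≢k → trans (*-congʳ (Id-offDiagonal (j≢k ∘ ≡.sym))) (zeroˡ _)))
                      (trans (*-congʳ (Id-diagonal k)) (*-identityˡ _))

  ·ᵛ-assoc : ∀ {m n} {I : Set} (A : Matrix I (Fin m)) (B : Matrix (Fin m) (Fin n)) x i →
             ((A · B) ·ᵛ x) i ≈ (A ·ᵛ (B ·ᵛ x)) i
  ·ᵛ-assoc A B x i = sum-assoc (A i) B x

  ·ᵛ-congʳ : ∀ {n} {I : Set} (A : Matrix I (Fin n)) {x y : Vec (Fin n)} → (∀ j → x j ≈ y j) → ∀ i → (A ·ᵛ x) i ≈ (A ·ᵛ y) i
  ·ᵛ-congʳ A x≈y i = sum-cong-≋ λ j → *-congˡ (x≈y j)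

  ·ᵛ-congˡ : ∀ {n} {I : Set} {A B : Matrix I (Fin n)} → A ≋ B → ∀ x i → (A ·ᵛ x) i ≈ (B ·ᵛ x) i
  ·ᵛ-congˡ A≋B x i = sum-cong-≋ λ j → *-congʳ (A≋B i j)

  -- For a Z-matrix this characterizes K-matrices. It is the form in which the K-property is carried
  -- through the exchange of rows.
  Semipositive : ∀ {n} → Square n → Set _
  Semipositive W = ∃ λ t → (∀ i → 0# ≤ t i) × (∀ i → 0# < (W ·ᵛ t) i)

  -- Gaussian elimination preserves all signs: the witness u makes the pivot positive, the Schur
  -- complement only lowers entries and stays a Z-matrix, and the new right-hand side and the back
  -- substitution stay nonnegative. The witness is taken for the transpose so that solving
  -- `W ᵀ t ≈ 𝟏` turns a witness for W into one for `W ᵀ`.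
  solve-Z : ∀ {n} (W : Square n) → IsZ W → Semipositive (W ᵀ) →
            (b : Vec (Fin n)) → (∀ i → 0# ≤ b i) → ∃ λ t → (∀ i → 0# ≤ t i) × (∀ i → (W ·ᵛ t) i ≈ b i)
  solve-Z {zero}  W W-Z _ b 0≤b = (λ ()) , (λ ()) , (λ ())
  solve-Z {suc n} W W-Z (u , 0≤u , 0<uW) b 0≤b =
    t , (λ { zero → 0≤t₀ ; (suc i) → 0≤t′ i }) , (λ { zero → row₀ ; (suc i) → row i })
    where
    a : Carrier
    a = W zero zero
    0<a : 0# < a
    0<a = pos-left (0≤u zero) (<-≤-trans (0<uW zero)
      (≤-respʳ-≈ (+-identityʳ _) (+-monoʳ-≤ (a * u zero) (sum-nonpos λ i → nonpos*nonneg (W-Z (suc i) zero (λ ())) (0≤u (suc i))))))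
    w : Carrier
    w = recip 0<a
    0≤w : 0# ≤ w
    0≤w = <⇒≤ (recip-pos 0<a)
    aw≈1 : a * w ≈ 1#
    aw≈1 = *-recip 0<a
    S : Square n
    S = schur W w
    S-Z : IsZ S
    S-Z i j i≢j = 0≤-⇒≤0 (≤-respʳ-≈
      (solve 4 (λ x y w z → :- x :+ w :* (y :* z) := :- (x :- y :* (w :* z))) refl (W (suc i) (suc j)) (W (suc i) zero) w (W zero (suc j)))
      (nonneg+nonneg (≤0⇒0≤- (W-Z (suc i) (suc j) (i≢j ∘ Fin.suc-injective)))
                     (nonneg*nonneg 0≤w (nonpos*nonpos (W-Z (suc i) zero (λ ())) (W-Z zero (suc j) (λ ()))))))
    Sᵀ-semipositive : Semipositive (S ᵀ)
    -- Adding to column `suc j` the nonnegative multiple `- (w * W zero (suc j))` of column zero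
    -- clears its first entry and leaves column j of S. So `u zero` drops out, and the weighted sum
    -- does not decrease.
    Sᵀ-semipositive = u ∘ suc , 0≤u ∘ suc , λ j → <-respʳ-≈ (eq j)
      (pos+nonneg (0<uW (suc j)) (nonneg*nonneg (nonneg*nonneg (<⇒≤ (0<uW zero)) 0≤w) (≤0⇒0≤- (W-Z zero (suc j) (λ ())))))
      where
      colSum : Fin (suc n) → Carrier
      colSum j = sum λ i → W (suc i) j * u (suc i)
      eq : ∀ j → (W ᵀ ·ᵛ u) (suc j) + (W ᵀ ·ᵛ u) zero * w * - W zero (suc j) ≈ (S ᵀ ·ᵛ (u ∘ suc)) j
      eq j = begin-equality
        (W zero (suc j) * u zero + colSum (suc j)) + (a * u zero + colSum zero) * w * - W zero (suc j)
          ≈⟨ solve 6 (λ r u s a z w → (r :* u :+ s) :+ (a :* u :+ z) :* w :* :- r := (s :- r :* w :* z) :+ r :* u :* (𝟙 :- a :* w)) refl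
               (W zero (suc j)) (u zero) (colSum (suc j)) a (colSum zero) w ⟩
        (colSum (suc j) - W zero (suc j) * w * colSum zero) + W zero (suc j) * u zero * (1# - a * w)
          ≈⟨ +-congˡ (trans (*-congˡ (trans (+-congˡ (-‿cong aw≈1)) (-‿inverseʳ 1#))) (zeroʳ _)) ⟩
        (colSum (suc j) - W zero (suc j) * w * colSum zero) + 0#
          ≈⟨ +-identityʳ _ ⟩
        colSum (suc j) - W zero (suc j) * w * colSum zero
          ≈⟨ schur-·ᵛ (W ᵀ) w (u ∘ suc) j ⟨
        (schur (W ᵀ) w ·ᵛ (u ∘ suc)) j
          ≈⟨ ·ᵛ-congˡ {A = schur (W ᵀ) w} {S ᵀ} (λ j i → solve 4 (λ x y w z → x :- y :* (w :* z) := x :- z :* (w :* y)) refl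
               (W (suc i) (suc j)) (W zero (suc j)) w (W (suc i) zero)) (u ∘ suc) j ⟩
        (S ᵀ ·ᵛ (u ∘ suc)) j ∎
    b′ : Vec (Fin n)
    b′ i = b (suc i) - W (suc i) zero * (w * b zero)
    0≤b′ : ∀ i → 0# ≤ b′ i
    0≤b′ i = ≤⇒0≤- (≤-trans (nonpos*nonneg (W-Z (suc i) zero (λ ())) (nonneg*nonneg 0≤w (0≤b zero))) (0≤b (suc i)))
    solution : ∃ λ t → (∀ i → 0# ≤ t i) × (∀ i → (S ·ᵛ t) i ≈ b′ i)
    solution = solve-Z S S-Z Sᵀ-semipositive b′ 0≤b′
    t′ : Vec (Fin n)
    t′ = proj₁ solution
    0≤t′ : ∀ i → 0# ≤ t′ i
    0≤t′ = proj₁ (proj₂ solution)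
    rowSum : Fin (suc n) → Carrier
    rowSum i = sum λ j → W i (suc j) * t′ j
    t₀ : Carrier
    t₀ = w * (b zero - rowSum zero)
    0≤t₀ : 0# ≤ t₀
    0≤t₀ = nonneg*nonneg 0≤w (≤⇒0≤- (≤-trans (sum-nonpos (λ j → nonpos*nonneg (W-Z zero (suc j) (λ ())) (0≤t′ j))) (0≤b zero)))
    t : Vec (Fin (suc n))
    t zero    = t₀
    t (suc i) = t′ i
    row₀ : (W ·ᵛ t) zero ≈ b zero
    row₀ = begin-equality
      a * (w * (b zero - rowSum zero)) + rowSum zero   ≈⟨ solve 4 (λ a w b r → a :* (w :* (b :- r)) :+ r := (a :* w) :* (b :- r) :+ r) refl a w (b zero) (rowSum zero) ⟩
      (a * w) * (b zero - rowSum zero) + rowSum zero   ≈⟨ +-congʳ (*-congʳ aw≈1) ⟩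
      1# * (b zero - rowSum zero) + rowSum zero        ≈⟨ solve 2 (λ b r → 𝟙 :* (b :- r) :+ r := b) refl (b zero) (rowSum zero) ⟩
      b zero                                           ∎
    row : ∀ i → (W ·ᵛ t) (suc i) ≈ b (suc i)
    row i = begin-equality
      s * (w * (b zero - rowSum zero)) + rowSum (suc i)
        ≈⟨ solve 5 (λ s w b r z → s :* (w :* (b :- r)) :+ z := (z :- s :* w :* r) :+ s :* (w :* b)) refl s w (b zero) (rowSum zero) (rowSum (suc i)) ⟩
      (rowSum (suc i) - s * w * rowSum zero) + s * (w * b zero)
        ≈⟨ +-congʳ (trans (sym (schur-·ᵛ W w t′ i)) (proj₂ (proj₂ solution) i)) ⟩
      (b (suc i) - s * (w * b zero)) + s * (w * b zero)
        ≈⟨ solve 2 (λ x y → (x :- y) :+ y := x) refl (b (suc i)) (s * (w * b zero)) ⟩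
      b (suc i) ∎
      where s = W (suc i) zero

  IsZ-ᵀ : ∀ {n} {W : Square n} → IsZ W → IsZ (W ᵀ)
  IsZ-ᵀ W-Z i j i≢j = W-Z j i (i≢j ∘ ≡.sym)

  Semipositive-ᵀ : ∀ {n} (W : Square n) → IsZ W → Semipositive W → Semipositive (W ᵀ)
  Semipositive-ᵀ W W-Z W-semipositive with solve-Z (W ᵀ) (IsZ-ᵀ {W = W} W-Z) W-semipositive (λ _ → 1#) (λ _ → <⇒≤ 0<1)
  ... | t , 0≤t , Wᵀt≈1 = t , 0≤t , λ i → <-respʳ-≈ (sym (Wᵀt≈1 i)) 0<1

  -- Nonnegative solutions for the unit vectors are the columns of a right inverse V; those for the
  -- transpose are the rows of a left inverse U, and associativity identifies the two.
  nonneg-inverse : ∀ {n} (W : Square n) → IsZ W → Semipositive W →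
                   ∃ λ V → IsInverse W V × (∀ i j → 0# ≤ V i j)
  nonneg-inverse {n} W W-Z W-semipositive = V , (WV≋Id , VW≋Id) , λ i k → proj₁ (proj₂ (column k)) i
    where
    column : ∀ k → ∃ λ t → (∀ i → 0# ≤ t i) × (∀ i → (W ·ᵛ t) i ≈ Id i k)
    column k = solve-Z W W-Z (Semipositive-ᵀ W W-Z W-semipositive) (λ i → Id i k) (λ i → 0≤Id i k)
    row : ∀ k → ∃ λ t → (∀ i → 0# ≤ t i) × (∀ i → (W ᵀ ·ᵛ t) i ≈ Id i k)
    row k = solve-Z (W ᵀ) (IsZ-ᵀ {W = W} W-Z) W-semipositive (λ i → Id i k) (λ i → 0≤Id i k)
    V U : Square n
    V i k = proj₁ (column k) i
    U k i = proj₁ (row k) i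
    WV≋Id : W · V ≋ Id
    WV≋Id i k = proj₂ (proj₂ (column k)) i
    Id-sym : ∀ i k → Id {n} i k ≈ Id k i
    Id-sym i k with i Fin.≟ k
    ... | yes ≡.refl = sym (Id-diagonal i)
    ... | no  i≢k    = sym (Id-offDiagonal (i≢k ∘ ≡.sym))
    UW≋Id : U · W ≋ Id
    UW≋Id k i = trans (sum-cong-≋ λ j → *-comm (U k j) (W j i)) (trans (proj₂ (proj₂ (row k)) i) (Id-sym i k))
    V≋U : V ≋ U
    V≋U k i = begin-equality
      V k i                        ≈⟨ sum-Id* (λ j → V j i) k ⟨
      (Id ·ᵛ λ j → V j i) k        ≈⟨ ·ᵛ-congˡ {B = Id} UW≋Id (λ j → V j i) k ⟨
      ((U · W) ·ᵛ λ j → V j i) k   ≈⟨ ·ᵛ-assoc U W (λ j → V j i) k ⟩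
      (U ·ᵛ λ j → (W · V) j i) k   ≈⟨ ·ᵛ-congʳ U (λ j → WV≋Id j i) k ⟩
      (U ·ᵛ λ j → Id j i) k        ≈⟨ sum-*Id (U k) i ⟩
      U k i                        ∎
    VW≋Id : V · W ≋ Id
    VW≋Id k i = trans (sum-cong-≋ λ j → *-congʳ {W j i} (V≋U k j)) (UW≋Id k i)

  Z-monotone : ∀ {n} (W : Square n) → IsZ W → Semipositive W → ∀ {x y} →
             (∀ i → (W ·ᵛ x) i ≤ (W ·ᵛ y) i) → ∀ i → x i ≤ y i
  Z-monotone W W-Z W-semipositive {x} {y} Wx≤Wy i with nonneg-inverse W W-Z W-semipositive
  ... | V , (_ , VW≋Id) , 0≤V = ≤-respˡ-≈ (cancel x) (≤-respʳ-≈ (cancel y) (sum-mono-≤ λ j → *-monoˡ-≤ (0≤V i j) (Wx≤Wy j)))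
    where
    cancel : ∀ x → (V ·ᵛ (W ·ᵛ x)) i ≈ x i
    cancel x = trans (sym (·ᵛ-assoc V W x i)) (trans (·ᵛ-congˡ {B = Id} VW≋Id x i) (sum-Id* x i))

-- Selections of one element per block

_[_≔_] : ∀ {n} {b : Type n} → MaxCompl b → (j : Fin n) → Fin (b j) → MaxCompl b
(B [ j ≔ k ]) l with l Fin.≟ j
... | yes ≡.refl = k
... | no  _      = B l

≔-at : ∀ {n} {b : Type n} (B : MaxCompl b) j k → (B [ j ≔ k ]) j ≡ k
≔-at B j k with j Fin.≟ j
... | yes ≡.refl = ≡.refl
... | no  j≢j    = contradiction ≡.refl j≢j

mix : ∀ {n} {b : Type n} → ℕ → (B C : MaxCompl b) → MaxCompl b
mix m B C l with toℕ l ℕ.<? m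
... | yes _ = C l
... | no  _ = B l

mix-< : ∀ {n} {b : Type n} m (B C : MaxCompl b) {l} → toℕ l ℕ.< m → mix m B C l ≡ C l
mix-< m B C {l} l<m with toℕ l ℕ.<? m
... | yes _   = ≡.refl
... | no  l≮m = contradiction l<m l≮m

mix-≮ : ∀ {n} {b : Type n} m (B C : MaxCompl b) {l} → ¬ (toℕ l ℕ.< m) → mix m B C l ≡ B l
mix-≮ m B C {l} l≮m with toℕ l ℕ.<? m
... | yes l<m = contradiction l<m l≮m
... | no  _   = ≡.refl

mix-step : ∀ {n} {b : Type n} m (B C : MaxCompl b) {l} → toℕ l ≢ m → mix (suc m) B C l ≡ mix m B C l
mix-step m B C {l} l≢m with toℕ l ℕ.<? m
... | yes l<m = mix-< (suc m) B C (ℕ.m<n⇒m<1+n l<m)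
... | no  l≮m = mix-≮ (suc m) B C (λ l<1+m → l≮m (ℕ.≤∧≢⇒< (ℕ.s≤s⁻¹ l<1+m) l≢m))

-- The selections `mix 0 B C`, ..., `mix n B C` lead from B to C and change one block at a time.
-- `P-resp` closes the two ends, where selections, being functions, agree only pointwise.
mix-induction : ∀ {n} {b : Type n} {p} (P : MaxCompl b → Set p) →
  (∀ {B C} → (∀ l → B l ≡ C l) → P B → P C) →
  (∀ {B C} j → (∀ l → l ≢ j → B l ≡ C l) → P B → P C) →
  ∀ B → P B → ∀ C → P C
mix-induction {n} P P-resp P-step B PB C = P-resp (λ l → mix-< n B C (Fin.toℕ<n l)) (go n ℕ.≤-refl)
  where
  go : ∀ m → m ℕ.≤ n → P (mix m B C)
  go zero    _   = P-resp (λ l → ≡.sym (mix-≮ 0 B C (λ ()))) PB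
  go (suc m) m<n = P-step (fromℕ< m<n)
    (λ l l≢m → ≡.sym (mix-step m B C (λ l≡m → l≢m (Fin.toℕ-injective (≡.trans l≡m (≡.sym (Fin.toℕ-fromℕ< m<n)))))))
    (go m (ℕ.<⇒≤ m<n))

-- Exchange of rows and policy iteration

module RowFamily {c ℓ₁ ℓ₂} (ℝ : RealNumbers c ℓ₁ ℓ₂) where

  open OrderedField ℝ
  open Real ℝ
  open ZMatrix ℝ

  argmax-Fin : ∀ {m} (g : Fin (suc m) → Carrier) → ∃ λ k → ∀ k′ → g k′ ≤ g k
  argmax-Fin {zero}  g = zero , λ { zero → ≤-refl }
  argmax-Fin {suc m} g with argmax-Fin (g ∘ suc)
  ... | k , k-max with <-≤-connex (g zero) (g (suc k))
  ...   | inj₁ g₀<gₖ = suc k , λ { zero → <⇒≤ g₀<gₖ ; (suc k′) → k-max k′ }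
  ...   | inj₂ gₖ≤g₀ = zero , λ { zero → ≤-refl ; (suc k′) → ≤-trans (k-max k′) gₖ≤g₀ }

  cons : ∀ {n} {b : Type (suc n)} → Fin (b zero) → MaxCompl (b ∘ suc) → MaxCompl b
  cons k B zero    = k
  cons k B (suc j) = B j

  -- The best tail is found for each choice in the first block, then the best such choice. As C
  -- agrees with `cons (C zero) (C ∘ suc)` only pointwise, f has to respect such agreement.
  argmax : ∀ {n} (b : Type n) (f : MaxCompl (b +𝟏) → Carrier) →
           (∀ {B C} → (∀ l → B l ≡ C l) → f B ≤ f C) → ∃ λ B → ∀ C → f C ≤ f B
  argmax {zero}  b f f-resp = (λ ()) , λ C → f-resp (λ ())
  argmax {suc n} b f f-resp = cons k (proj₁ (best k)) , λ C → begin
    f C                               ≤⟨ f-resp (λ { zero → ≡.refl ; (suc l) → ≡.refl }) ⟩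
    f (cons (C zero) (C ∘ suc))       ≤⟨ proj₂ (best (C zero)) (C ∘ suc) ⟩
    f (cons (C zero) (proj₁ (best (C zero))))  ≤⟨ k-max (C zero) ⟩
    f (cons k (proj₁ (best k)))       ∎
    where
    best : ∀ k → ∃ λ B → ∀ C → f (cons k C) ≤ f (cons k B)
    best k = argmax (b ∘ suc) (f ∘ cons k) (λ B≡C → f-resp λ { zero → ≡.refl ; (suc l) → B≡C l })
    maximal : ∃ λ k → ∀ k′ → f (cons k′ (proj₁ (best k′))) ≤ f (cons k (proj₁ (best k)))
    maximal = argmax-Fin (λ k → f (cons k (proj₁ (best k))))
    k = proj₁ maximal
    k-max = proj₂ maximal

  sum-≥⇒≥ : ∀ {n} {x y : Vec (Fin n)} → (∀ i → x i ≤ y i) → sum y ≤ sum x → ∀ i → y i ≤ x i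
  sum-≥⇒≥ {x = x} {y} x≤y ∑y≤∑x i = 0≤-⇒≤ (begin
    0#                       ≤⟨ ≤⇒0≤- ∑y≤∑x ⟩
    sum x - sum y            ≈⟨ solve 2 (λ x y → x :- y := :- (y :- x)) refl (sum x) (sum y) ⟩
    - (sum y - sum x)        ≈⟨ -‿cong (sum-minus y x) ⟨
    - (sum λ i → y i - x i)  ≤⟨ 0≤-⇒≤ (≤-respʳ-≈ (solve 2 (λ a b → a :- b := :- b :- :- a) refl _ _) (≤⇒0≤- (sum-≥-term (λ i → ≤⇒0≤- (x≤y i)) i))) ⟩
    - (y i - x i)            ≈⟨ solve 2 (λ x y → :- (y :- x) := x :- y) refl (x i) (y i) ⟩
    x i - y i                ∎)

  module _ {n} {b : Type n} (R W : BlockMatrix (b +𝟏)) (X : Square n) (RX≋W : R · X ≋ W)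
    (W-Z : IsBlockZ W)
    (no-reversal : ∀ (B : MaxCompl (b +𝟏)) z → (∀ j → z j * (R ·ᵛ z) (j , B j) ≤ 0#) → ∀ j → z j ≈ 0#)
    where

    Good : MaxCompl (b +𝟏) → Set _
    Good B = Semipositive (representative W B)

    Good-resp : ∀ {B C} → (∀ l → B l ≡ C l) → Good B → Good C
    Good-resp B≡C (t , 0≤t , 0<Wt) = t , 0≤t , λ l → ≡.subst (λ k → 0# < (W ·ᵛ t) (l , k)) (B≡C l) (0<Wt l)

    -- Moving t along the nonnegative solution v of W_B v = e_j only changes
    -- the j-th row of W_B t, and it changes the new j-th row at the rate (W v) (j , C j) > 0.

    Good-switch : ∀ {B C} j → (∀ l → l ≢ j → B l ≡ C l) → Good B → Good C
    Good-switch {B} {C} j B≡C good@(t , 0≤t , 0<Wt) with nonneg-inverse (representative W B) (W-Z B) good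
    ... | V , (WV≋Id , _) , 0≤V = t⁺ , 0≤t⁺ , 0<Wt⁺
      where
      v z : Vec (Fin n)
      v i = V i j
      z = X ·ᵛ v
      Rz≈Wv : ∀ r → (R ·ᵛ z) r ≈ (W ·ᵛ v) r
      Rz≈Wv r = trans (sym (·ᵛ-assoc R X v r)) (·ᵛ-congˡ RX≋W v r)
      Wv-off : ∀ l → l ≢ j → (W ·ᵛ v) (l , C l) ≈ 0#
      Wv-off l l≢j = ≡.subst (λ k → (W ·ᵛ v) (l , k) ≈ 0#) (B≡C l l≢j) (trans (WV≋Id l j) (Id-offDiagonal l≢j))
      α : Carrier
      α = (W ·ᵛ v) (j , C j)
      -- On the rows of B, `R z` is the j-th unit vector; on those of C it is zero outside block j
      -- and α in it. If α ≤ 0, the sign of `z j` decides which selection reverses z: C when it is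
      -- positive, B otherwise.
      reversed : α ≤ 0# → ∀ i → z i ≈ 0#
      reversed α≤0 with <-≤-connex 0# (z j)
      ... | inj₁ 0<zⱼ = no-reversal C z reversal
        where
        reversal : ∀ l → z l * (R ·ᵛ z) (l , C l) ≤ 0#
        reversal l with l Fin.≟ j
        ... | yes ≡.refl = nonneg*nonpos (<⇒≤ 0<zⱼ) (≤-respˡ-≈ (sym (Rz≈Wv (l , C l))) α≤0)
        ... | no  l≢j    = ≤-reflexive (trans (*-congˡ (trans (Rz≈Wv (l , C l)) (Wv-off l l≢j))) (zeroʳ _))
      ... | inj₂ zⱼ≤0 = no-reversal B z reversal
        where
        reversal : ∀ l → z l * (R ·ᵛ z) (l , B l) ≤ 0#
        reversal l with l Fin.≟ j
        ... | yes ≡.refl = nonpos*nonneg zⱼ≤0 (≤-respʳ-≈ (sym (trans (Rz≈Wv (l , B l)) (WV≋Id l l))) (0≤Id l l))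
        ... | no  l≢j    = ≤-reflexive (trans (*-congˡ (trans (Rz≈Wv (l , B l)) (trans (WV≋Id l j) (Id-offDiagonal l≢j)))) (zeroʳ _))
      0<α : 0# < α
      0<α with <-≤-connex 0# α
      ... | inj₁ 0<α = 0<α
      ... | inj₂ α≤0 = contradiction (begin-equality
        0#                     ≈⟨ sum-≈0 (λ i → trans (*-congˡ {R (j , B j) i} (reversed α≤0 i)) (zeroʳ _)) ⟨
        (R ·ᵛ z) (j , B j)     ≈⟨ trans (Rz≈Wv (j , B j)) (trans (WV≋Id j j) (Id-diagonal j)) ⟩
        1#                     ∎) 0≉1
      ω : Carrier
      ω = (W ·ᵛ t) (j , C j)
      step : ∃ λ β → 0# ≤ β × 0# < ω + β * α
      step with <-≤-connex 0# ω
      ... | inj₁ 0<ω = 0# , ≤-refl , <-respʳ-≈ (solve 2 (λ ω α → ω := ω :+ 𝟘 :* α) refl ω α) 0<ω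
      -- This β solves ω + βα = 1; it is nonnegative since ω ≤ 0 < α.
      ... | inj₂ ω≤0 = (1# - ω) * recip 0<α , nonneg*nonneg (≤⇒0≤- (≤-trans ω≤0 (<⇒≤ 0<1))) (<⇒≤ (recip-pos 0<α)) , <-respʳ-≈ (sym (begin-equality
        ω + (1# - ω) * recip 0<α * α    ≈⟨ solve 3 (λ ω ρ α → ω :+ (𝟙 :- ω) :* ρ :* α := ω :+ (𝟙 :- ω) :* (α :* ρ)) refl ω (recip 0<α) α ⟩
        ω + (1# - ω) * (α * recip 0<α)  ≈⟨ +-congˡ (*-congˡ (*-recip 0<α)) ⟩
        ω + (1# - ω) * 1#               ≈⟨ solve 1 (λ ω → ω :+ (𝟙 :- ω) :* 𝟙 := 𝟙) refl ω ⟩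
        1#                              ∎)) 0<1
      β : Carrier
      β = proj₁ step
      t⁺ : Vec (Fin n)
      t⁺ i = t i + β * v i
      0≤t⁺ : ∀ i → 0# ≤ t⁺ i
      0≤t⁺ i = nonneg+nonneg (0≤t i) (nonneg*nonneg (proj₁ (proj₂ step)) (0≤V i j))
      Wt⁺ : ∀ r → (W ·ᵛ t⁺) r ≈ (W ·ᵛ t) r + β * (W ·ᵛ v) r
      Wt⁺ r = begin-equality
        (W ·ᵛ t⁺) r
          ≈⟨ (sum-cong-≋ λ i → solve 4 (λ w t β v → w :* (t :+ β :* v) := w :* t :+ β :* (w :* v)) refl (W r i) (t i) β (v i)) ⟩
        (sum λ i → W r i * t i + β * (W r i * v i))
          ≈⟨ ∑-distrib-+ (λ i → W r i * t i) (λ i → β * (W r i * v i)) ⟩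
        (W ·ᵛ t) r + (sum λ i → β * (W r i * v i))
          ≈⟨ +-congˡ (*-distribˡ-sum β (λ i → W r i * v i)) ⟨
        (W ·ᵛ t) r + β * (W ·ᵛ v) r ∎
      0<Wt⁺ : ∀ l → 0# < (W ·ᵛ t⁺) (l , C l)
      0<Wt⁺ l with l Fin.≟ j
      ... | yes ≡.refl = <-respʳ-≈ (sym (Wt⁺ (l , C l))) (proj₂ (proj₂ step))
      ... | no  l≢j    = <-respʳ-≈ (sym (trans (Wt⁺ (l , C l)) (trans (+-congˡ (trans (*-congˡ (Wv-off l l≢j)) (zeroʳ β))) (+-identityʳ _))))
                           (≡.subst (λ k → 0# < (W ·ᵛ t) (l , k)) (B≡C l l≢j) (0<Wt l))

    -- Policy iteration: among the vectors t_B with W_B t_B ≈ 𝟏, a switch to a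
    -- row of W_B t_B below 1 would increase the sum of the entries.

    optimum : (value : MaxCompl (b +𝟏) → Vec (Fin n)) → (∀ B j → (W ·ᵛ value B) (j , B j) ≈ 1#) →
      (∀ C t → (∀ j → (W ·ᵛ t) (j , C j) ≤ 1#) → ∀ j → t j ≤ value C j) →
      ∀ B → (∀ C → sum (value C) ≤ sum (value B)) → ∀ r → 1# ≤ (W ·ᵛ value B) r
    optimum value W-value ≤-value B best (j , k) with <-≤-connex ((W ·ᵛ value B) (j , k)) 1#
    ... | inj₂ 1≤Wt = 1≤Wt
    -- Comparison gives `value B` ≤ `value C`, and maximality of the sum makes this an equality, so
    -- the row (j , k) already takes the value 1 that it has for C.
    ... | inj₁ Wt<1 = ≤-reflexive (begin-equality
      1#                          ≈⟨ W-value C j ⟨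
      (W ·ᵛ value C) (j , C j)    ≡⟨ ≡.cong (λ k → (W ·ᵛ value C) (j , k)) (≔-at B j k) ⟩
      (W ·ᵛ value C) (j , k)      ≈⟨ ·ᵛ-congʳ W (λ i → ≤-antisym (value-C≤ i) (≤-value-C i)) (j , k) ⟩
      (W ·ᵛ value B) (j , k)      ∎)
      where
      C : MaxCompl (b +𝟏)
      C = B [ j ≔ k ]
      Wt≤1 : ∀ l → (W ·ᵛ value B) (l , C l) ≤ 1#
      Wt≤1 l with l Fin.≟ j
      ... | yes ≡.refl = <⇒≤ Wt<1
      ... | no  l≢j    = ≤-reflexive (W-value B l)
      ≤-value-C : ∀ i → value B i ≤ value C i
      ≤-value-C = ≤-value C (value B) Wt≤1
      value-C≤ : ∀ i → value C i ≤ value B i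
      value-C≤ = sum-≥⇒≥ ≤-value-C (best C)

    common-solution : ∀ B → Good B → ∃ λ t → (∀ j → 0# ≤ t j) × (∀ r → 1# ≤ (W ·ᵛ t) r)
    common-solution B₀ good₀ =
      value B , proj₁ (proj₂ (solution B)) , optimum value W-value ≤-value B (proj₂ best)
      where
      good : ∀ B → Good B
      good = mix-induction Good Good-resp Good-switch B₀ good₀
      solution : ∀ B → ∃ λ t → (∀ i → 0# ≤ t i) × (∀ i → (representative W B ·ᵛ t) i ≈ 1#)
      solution B = solve-Z (representative W B) (W-Z B) (Semipositive-ᵀ (representative W B) (W-Z B) (good B)) (λ _ → 1#) (λ _ → <⇒≤ 0<1)
      value : ∀ B → Vec (Fin n)
      value B = proj₁ (solution B)
      W-value : ∀ B j → (W ·ᵛ value B) (j , B j) ≈ 1#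
      W-value B = proj₂ (proj₂ (solution B))
      ≤-value : ∀ C t → (∀ j → (W ·ᵛ t) (j , C j) ≤ 1#) → ∀ j → t j ≤ value C j
      ≤-value C t Wt≤1 = Z-monotone (representative W C) (W-Z C) (good C) λ j → ≤-respʳ-≈ (sym (W-value C j)) (Wt≤1 j)
      -- The solutions are computed from selections as functions; for selections that agree only
      -- pointwise they are compared by monotonicity.
      value-resp : ∀ {B C} → (∀ l → B l ≡ C l) → sum (value B) ≤ sum (value C)
      value-resp {B} {C} B≡C = sum-mono-≤ (≤-value C (value B) λ j →
        ≤-reflexive (≡.subst (λ k → (W ·ᵛ value B) (j , k) ≈ 1#) (B≡C j) (W-value B j)))
      best : ∃ λ B → ∀ C → sum (value C) ≤ sum (value B)
      best = argmax b (λ B → sum (value B)) value-resp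
      B : MaxCompl (b +𝟏)
      B = proj₁ best

-- Positive scaling of linear complementarity problems

module Scaling {c ℓ₁ ℓ₂} (ℝ : RealNumbers c ℓ₁ ℓ₂) where

  open OrderedField ℝ
  open Real ℝ
  open Determinant ℝ using (IsP-scale)

  Idᴺ-diagonal : ∀ {n} {b : Type n} (r : N b) → Idᴺ {b = b} r r ≈ 1#
  Idᴺ-diagonal {b = b} r with _≟ᴺ_ {b = b} r r
  ... | yes _   = refl
  ... | no  r≢r = contradiction ≡.refl r≢r

  Idᴺ-offDiagonal : ∀ {n} {b : Type n} {r t : N b} → r ≢ t → Idᴺ {b = b} r t ≈ 0#
  Idᴺ-offDiagonal {b = b} {r} {t} r≢t with _≟ᴺ_ {b = b} r t
  ... | yes r≡t = contradiction r≡t r≢t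
  ... | no  _   = refl

  Idᴺ-scale : ∀ {n} {b : Type n} (x y : N b → Carrier) → (∀ r → x r * y r ≈ 1#) →
              ∀ r t → x r * y t * Idᴺ {b = b} r t ≈ Idᴺ {b = b} r t
  Idᴺ-scale {b = b} x y xy≈1 r t with _≟ᴺ_ {b = b} r t
  ... | yes ≡.refl = trans (*-identityʳ _) (xy≈1 r)
  ... | no  _      = zeroʳ _

  sumᴺ-cong : ∀ {n} {b : Type n} {f g : N b → Carrier} → (∀ r → f r ≈ g r) → sumᴺ {b = b} f ≈ sumᴺ {b = b} g
  sumᴺ-cong f≈g = sum-cong-≋ λ j → sum-cong-≋ λ i → f≈g (j , i)

  *-distribˡ-sumᴺ : ∀ {n} {b : Type n} x (f : N b → Carrier) → x * sumᴺ {b = b} f ≈ sumᴺ {b = b} (λ r → x * f r)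
  *-distribˡ-sumᴺ x f = trans (*-distribˡ-sum x (λ j → sum λ i → f (j , i))) (sum-cong-≋ λ j → *-distribˡ-sum x (λ i → f (j , i)))

  sumᴺ-single : ∀ {n} {b : Type n} (r : N b) {f : N b → Carrier} → (∀ t → t ≢ r → f t ≈ 0#) → sumᴺ {b = b} f ≈ f r
  sumᴺ-single (j , i) f≈0 = trans
    (sum-single j (λ l l≢j → sum-≈0 λ k → f≈0 (l , k) (l≢j ∘ ≡.cong proj₁)))
    (sum-single i (λ k k≢i → f≈0 (j , k) (k≢i ∘ λ { ≡.refl → ≡.refl })))

  scale-inverse : ∀ {n} {b : Type n} {G G′ V : Matrix (N b) (N b)} (ρ ρ⁻¹ σ σ⁻¹ : N b → Carrier) →
    (∀ r → ρ r * ρ⁻¹ r ≈ 1#) → (∀ r → σ r * σ⁻¹ r ≈ 1#) → (∀ r k → G′ r k ≈ ρ r * G r k * σ k) →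
    IsInverseᴺ {b = b} G V → IsInverseᴺ {b = b} G′ (λ k r → σ⁻¹ k * V k r * ρ⁻¹ r)
  scale-inverse {b = b} {G} {G′} {V} ρ ρ⁻¹ σ σ⁻¹ ρρ⁻¹≈1 σσ⁻¹≈1 G′≈ρGσ (GV≋Id , VG≋Id) = right , left
    where
    right : _
    right r t = begin-equality
      (sumᴺ {b = b} λ k → G′ r k * (σ⁻¹ k * V k t * ρ⁻¹ t))
        ≈⟨ sumᴺ-cong {b = b} (λ k → trans (*-congʳ (G′≈ρGσ r k)) (trans
             (solve 6 (λ ρ g σ σ⁻¹ v ρ⁻¹ → ρ :* g :* σ :* (σ⁻¹ :* v :* ρ⁻¹) := (σ :* σ⁻¹) :* (ρ :* ρ⁻¹ :* (g :* v))) refl (ρ r) (G r k) (σ k) (σ⁻¹ k) (V k t) (ρ⁻¹ t))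
             (trans (*-congʳ (σσ⁻¹≈1 k)) (*-identityˡ _)))) ⟩
      (sumᴺ {b = b} λ k → ρ r * ρ⁻¹ t * (G r k * V k t))     ≈⟨ *-distribˡ-sumᴺ {b = b} (ρ r * ρ⁻¹ t) (λ k → G r k * V k t) ⟨
      ρ r * ρ⁻¹ t * (sumᴺ {b = b} λ k → G r k * V k t)       ≈⟨ *-congˡ (GV≋Id r t) ⟩
      ρ r * ρ⁻¹ t * Idᴺ {b = b} r t                          ≈⟨ Idᴺ-scale {b = b} ρ ρ⁻¹ ρρ⁻¹≈1 r t ⟩
      Idᴺ {b = b} r t                                        ∎
    left : _
    left k l = begin-equality
      (sumᴺ {b = b} λ r → σ⁻¹ k * V k r * ρ⁻¹ r * G′ r l)
        ≈⟨ sumᴺ-cong {b = b} (λ r → trans (*-congˡ (G′≈ρGσ r l)) (trans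
             (solve 6 (λ ρ g σ σ⁻¹ v ρ⁻¹ → σ⁻¹ :* v :* ρ⁻¹ :* (ρ :* g :* σ) := (ρ :* ρ⁻¹) :* (σ⁻¹ :* σ :* (v :* g))) refl (ρ r) (G r l) (σ l) (σ⁻¹ k) (V k r) (ρ⁻¹ r))
             (trans (*-congʳ (ρρ⁻¹≈1 r)) (*-identityˡ _)))) ⟩
      (sumᴺ {b = b} λ r → σ⁻¹ k * σ l * (V k r * G r l))     ≈⟨ *-distribˡ-sumᴺ {b = b} (σ⁻¹ k * σ l) (λ r → V k r * G r l) ⟨
      σ⁻¹ k * σ l * (sumᴺ {b = b} λ r → V k r * G r l)       ≈⟨ *-congˡ (VG≋Id k l) ⟩
      σ⁻¹ k * σ l * Idᴺ {b = b} k l                          ≈⟨ Idᴺ-scale {b = b} σ⁻¹ σ (λ r → trans (*-comm _ _) (σσ⁻¹≈1 r)) k l ⟩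
      Idᴺ {b = b} k l                                        ∎

  module _ {n} {a : Type n} where

    -- A change of units, ρ for w and q and κ for the columns belonging to z. The reciprocals are
    -- stored so that `unscale` reverses the relation by exchanging fields.
    record Scaled (A A′ : BlockMatrix a) (q q′ : Vec (N a)) : Set (c ⊔ ℓ₁ ⊔ ℓ₂) where
      field
        ρ ρ⁻¹   : N a → Carrier
        κ κ⁻¹   : Fin n → Carrier
        0<ρ     : ∀ r → 0# < ρ r
        0<ρ⁻¹   : ∀ r → 0# < ρ⁻¹ r
        0<κ     : ∀ l → 0# < κ l
        0<κ⁻¹   : ∀ l → 0# < κ⁻¹ l
        ρρ⁻¹≈1  : ∀ r → ρ r * ρ⁻¹ r ≈ 1#
        κκ⁻¹≈1  : ∀ l → κ l * κ⁻¹ l ≈ 1#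
        A′≈ρAκ  : ∀ r l → A′ r l ≈ ρ r * A r l * κ l
        q′≈ρq   : ∀ r → q′ r ≈ ρ r * q r

    unscale : ∀ {A A′ q q′} → Scaled A A′ q q′ → Scaled A′ A q′ q
    unscale {A} {A′} {q} {q′} s = record
      { ρ = ρ⁻¹ ; ρ⁻¹ = ρ ; κ = κ⁻¹ ; κ⁻¹ = κ ; 0<ρ = 0<ρ⁻¹ ; 0<ρ⁻¹ = 0<ρ ; 0<κ = 0<κ⁻¹ ; 0<κ⁻¹ = 0<κ
      ; ρρ⁻¹≈1 = λ r → trans (*-comm _ _) (ρρ⁻¹≈1 r)
      ; κκ⁻¹≈1 = λ l → trans (*-comm _ _) (κκ⁻¹≈1 l)
      ; A′≈ρAκ = λ r l → sym (begin-equality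
          ρ⁻¹ r * A′ r l * κ⁻¹ l                  ≈⟨ *-congʳ (*-congˡ (A′≈ρAκ r l)) ⟩
          ρ⁻¹ r * (ρ r * A r l * κ l) * κ⁻¹ l     ≈⟨ solve 5 (λ ρ⁻¹ ρ a κ κ⁻¹ → ρ⁻¹ :* (ρ :* a :* κ) :* κ⁻¹ := (ρ :* ρ⁻¹) :* (κ :* κ⁻¹) :* a) refl (ρ⁻¹ r) (ρ r) (A r l) (κ l) (κ⁻¹ l) ⟩
          (ρ r * ρ⁻¹ r) * (κ l * κ⁻¹ l) * A r l   ≈⟨ *-congʳ (*-cong (ρρ⁻¹≈1 r) (κκ⁻¹≈1 l)) ⟩
          1# * 1# * A r l                         ≈⟨ solve 1 (λ a → 𝟙 :* 𝟙 :* a := a) refl (A r l) ⟩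
          A r l                                   ∎)
      ; q′≈ρq = λ r → sym (begin-equality
          ρ⁻¹ r * q′ r            ≈⟨ *-congˡ (q′≈ρq r) ⟩
          ρ⁻¹ r * (ρ r * q r)     ≈⟨ solve 3 (λ ρ⁻¹ ρ q → ρ⁻¹ :* (ρ :* q) := (ρ :* ρ⁻¹) :* q) refl (ρ⁻¹ r) (ρ r) (q r) ⟩
          (ρ r * ρ⁻¹ r) * q r     ≈⟨ *-congʳ (ρρ⁻¹≈1 r) ⟩
          1# * q r                ≈⟨ *-identityˡ _ ⟩
          q r                     ∎)
      }
      where open Scaled s

    -- The basic solutions of w - A z = q are rescaled: w by ρ and z by κ⁻¹.

    rescale : ∀ {A A′ q q′} → Scaled A A′ q q′ → ∀ B V → IsInverseᴺ {b = a} (nonbasis A B) V →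
      ∃ λ V′ → IsInverseᴺ {b = a} (nonbasis A′ B) V′ ×
        ∀ k → ∃ λ τ → 0# < τ × (_·ᴺᵛ_ {b = a} V′ q′) k ≈ τ * (_·ᴺᵛ_ {b = a} V q) k
    rescale {A} {A′} {q} {q′} s B V isInverse =
      (λ k r → τ k * V k r * ρ⁻¹ r) ,
      scale-inverse {b = a} ρ ρ⁻¹ (columnScale ∘ outside B) τ ρρ⁻¹≈1 (στ≈1 ∘ outside B) (λ r k → column r (outside B k)) isInverse ,
      λ k → τ k , 0<τ (outside B k) , (begin-equality
        (sumᴺ {b = a} λ r → τ k * V k r * ρ⁻¹ r * q′ r)
          ≈⟨ sumᴺ-cong {b = a} (λ r → trans (*-congˡ (q′≈ρq r)) (trans
               (solve 5 (λ τ v ρ⁻¹ ρ q → τ :* v :* ρ⁻¹ :* (ρ :* q) := (ρ :* ρ⁻¹) :* (τ :* (v :* q))) refl (τ k) (V k r) (ρ⁻¹ r) (ρ r) (q r))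
               (trans (*-congʳ (ρρ⁻¹≈1 r)) (*-identityˡ _)))) ⟩
        (sumᴺ {b = a} λ r → τ k * (V k r * q r))
          ≈⟨ *-distribˡ-sumᴺ {b = a} (τ k) (λ r → V k r * q r) ⟨
        τ k * (sumᴺ {b = a} λ r → V k r * q r) ∎)
      where
      open Scaled s
      -- Scaling the rows by ρ multiplies the unit column (j , i) by `ρ (j , i)`, which `ρ⁻¹` has to
      -- undo; the column taken from - A receives the factor κ.
      columnScale columnScale⁻¹ : N (a +𝟏) → Carrier
      columnScale (j , k) with view k
      ... | ‵fromℕ     = κ j
      ... | ‵inject₁ i = ρ⁻¹ (j , i)
      columnScale⁻¹ (j , k) with view k
      ... | ‵fromℕ     = κ⁻¹ j
      ... | ‵inject₁ i = ρ (j , i)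
      τ : N a → Carrier
      τ = columnScale⁻¹ ∘ outside B
      στ≈1 : ∀ t → columnScale t * columnScale⁻¹ t ≈ 1#
      στ≈1 (j , k) with view k
      ... | ‵fromℕ     = κκ⁻¹≈1 j
      ... | ‵inject₁ i = trans (*-comm _ _) (ρρ⁻¹≈1 (j , i))
      0<τ : ∀ t → 0# < columnScale⁻¹ t
      0<τ (j , k) with view k
      ... | ‵fromℕ     = 0<κ⁻¹ j
      ... | ‵inject₁ i = 0<ρ (j , i)
      column : ∀ r t → [I∣- A′ ] r t ≈ ρ r * [I∣- A ] r t * columnScale t
      column r (j , k) with view k
      ... | ‵fromℕ     = trans (-‿cong (A′≈ρAκ r j)) (solve 3 (λ ρ a κ → :- (ρ :* a :* κ) := ρ :* :- a :* κ) refl (ρ r) (A r j) (κ j))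
      ... | ‵inject₁ i = sym (trans (solve 3 (λ ρ e σ → ρ :* e :* σ := ρ :* σ :* e) refl (ρ r) (Idᴺ {b = a} r (j , i)) (ρ⁻¹ (j , i)))
                                    (Idᴺ-scale {b = a} ρ ρ⁻¹ ρρ⁻¹≈1 r (j , i)))

    IsBlockP-scale : ∀ {A A′ : BlockMatrix a} (u : N a → Carrier) (v : Fin n → Carrier) →
      (∀ j i → 0# < u (j , i) * v j) → (∀ r l → A′ r l ≈ u r * A r l * v l) → IsBlockP A → IsBlockP A′
    IsBlockP-scale {A} {A′} u v 0<uv A′≈uAv A-P B =
      IsP-scale {A = representative A B} {representative A′ B} (λ j → u (j , B j)) v (λ j → 0<uv j (B j)) (λ j → A′≈uAv (j , B j)) (A-P B)

    Related : (A A′ : BlockMatrix a) (q q′ : Vec (N a)) (B : MaxCompl (a +𝟏)) (V : Matrix (N a) (N a)) → Set (c ⊔ ℓ₁ ⊔ ℓ₂)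
    Related A A′ q q′ B V = ∃ λ V′ → IsInverseᴺ {b = a} (nonbasis A′ B) V′ ×
      ∀ k → ∃ λ τ → 0# < τ × (_·ᴺᵛ_ {b = a} V′ q′) k ≈ τ * (_·ᴺᵛ_ {b = a} V q) k

    Negative : (A : BlockMatrix a) (q : Vec (N a)) (B : MaxCompl (a +𝟏)) → N a → Set (c ⊔ ℓ₁ ⊔ ℓ₂)
    Negative A q B k = ∃ λ V → IsInverseᴺ {b = a} (nonbasis A B) V × (_·ᴺᵛ_ {b = a} V q) k < 0#

    negative : ∀ A A′ q q′ B V k → (_·ᴺᵛ_ {b = a} V q) k < 0# → Related A A′ q q′ B V → Negative A′ q′ B k
    negative A A′ q q′ B V k Vq<0 (V′ , V′-inverse , related) =
      V′ , V′-inverse , <-respˡ-≈ (sym (proj₂ (proj₂ (related k)))) (pos*neg (proj₁ (proj₂ (related k))) Vq<0)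

    transfer : ∀ {A A′ q q′} → Scaled A A′ q q′ → ∀ B k → Negative A q B k → Negative A′ q′ B k
    transfer {A} {A′} {q} {q′} s B k (V , V-inverse , Vq<0) = negative A A′ q q′ B V k Vq<0 (rescale s B V V-inverse)

    -- Nondegeneracy speaks of every inverse, so an arbitrary inverse for A′ is carried back to A,
    -- where a zero entry would remain zero.
    Nondegenerate-scale : ∀ {A A′ q q′} → Scaled A A′ q q′ → Nondegenerate A q → Nondegenerate A′ q′
    Nondegenerate-scale {A} {A′} {q} {q′} s nondegenerate B V′ V′-inverse k V′q′≈0 =
      nondegenerate B (proj₁ related) (proj₁ (proj₂ related)) k
        (trans (proj₂ (proj₂ (proj₂ (proj₂ related) k))) (trans (*-congˡ V′q′≈0) (zeroʳ _)))
      where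
      related : Related A′ A q′ q B V′
      related = rescale (unscale s) B V′ V′-inverse

    ArisesFromPGLCP-scale : ∀ {A A′ q q′} → Scaled A A′ q q′ → ∀ {O : Orientation (a +𝟏)} →
      ArisesFromPGLCP A q O → ArisesFromPGLCP A′ q′ O
    ArisesFromPGLCP-scale {A} {A′} {q} {q′} s {O} arises = record
      { isP           = IsBlockP-scale {A} {A′} ρ κ (λ j i → *-pos _ _ (0<ρ (j , i)) (0<κ j)) A′≈ρAκ isP
      ; nondegenerate = Nondegenerate-scale {A} {A′} {q} {q′} s nondegenerate
      ; direction     = λ {B} e → mk⇔
          (λ o → transfer {A} {A′} {q} {q′} s B (entering e) (Equivalence.to (direction e) o))
          (λ x → Equivalence.from (direction e) (transfer {A′} {A} {q′} {q} (unscale s) B (entering e) x))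
      }
      where
      open Scaled s
      open ArisesFromPGLCP arises

-- In each block, the element of f comes last, as in a game of type a + 𝟏.

glue : ∀ {n} {a : Type n} {ℓ} {A : Set ℓ} → (Fin n → A) → (N a → A) → N (a +𝟏) → A
glue f g (j , k) with view k
... | ‵fromℕ     = f j
... | ‵inject₁ i = g (j , i)

glue-fromℕ : ∀ {n} {a : Type n} {ℓ} {A : Set ℓ} (f : Fin n → A) (g : N a → A) j → glue f g (j , fromℕ (a j)) ≡ f j
glue-fromℕ {a = a} f g j rewrite view-fromℕ (a j) = ≡.refl

glue-inject₁ : ∀ {n} {a : Type n} {ℓ} {A : Set ℓ} (f : Fin n → A) (g : N a → A) j i → glue f g (j , inject₁ i) ≡ g (j , i)
glue-inject₁ f g j i rewrite view-inject₁ i = ≡.refl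

-- One case distinction on `view k` serves two glued families at once, as when `Coefficients` is
-- compared with `Rows`.
glue₂-elim : ∀ {n} {a : Type n} {ℓ ℓ′ p} {A : Set ℓ} {B : Set ℓ′} (P : Fin n → A → B → Set p)
  (f : Fin n → A) (g : N a → A) (f′ : Fin n → B) (g′ : N a → B) →
  (∀ j → P j (f j) (f′ j)) → (∀ j i → P j (g (j , i)) (g′ (j , i))) →
  ∀ j k → P j (glue f g (j , k)) (glue f′ g′ (j , k))
glue₂-elim P f g f′ g′ Pf Pg j k with view k
... | ‵fromℕ     = Pf j
... | ‵inject₁ i = Pg j i

first : ∀ {m} → NonZero m → Fin m
first {suc m} _ = zero

-- Signature matrices and the owners of states

module Signature {c ℓ₁ ℓ₂} (ℝ : RealNumbers c ℓ₁ ℓ₂) where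

  open OrderedField ℝ
  open Real ℝ
  open Scaling ℝ
  open ZMatrix ℝ

  module _ {n} {a : Type n} (S : Square n) (S-diagonal : ∀ j l → j ≢ l → S j l ≈ 0#) where

    blockSignature-·ᴺᵛ : ∀ (q : Vec (N a)) r → (blockSignature a S ·ᴺᵛ q) r ≈ S (proj₁ r) (proj₁ r) * q r
    blockSignature-·ᴺᵛ q r@(j , _) = trans
      (sumᴺ-single {b = a} r {λ t → S j j * Idᴺ {b = a} r t * q t}
        (λ t t≢r → trans (*-congʳ (trans (*-congˡ (Idᴺ-offDiagonal {b = a} (t≢r ∘ ≡.sym))) (zeroʳ _))) (zeroˡ _)))
      (*-congʳ (trans (*-congˡ (Idᴺ-diagonal {b = a} r)) (*-identityʳ _)))

    signature-conjugate : ∀ (M : BlockMatrix a) r l →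
      (blockSignature a S ·ᴺ M · S) r l ≈ S (proj₁ r) (proj₁ r) * M r l * S l l
    signature-conjugate M r l = trans
      (sum-single l {λ k → (blockSignature a S ·ᴺ M) r k * S k l} (λ k k≢l → trans (*-congˡ (S-diagonal k l k≢l)) (zeroʳ _)))
      (*-congʳ (blockSignature-·ᴺᵛ (λ t → M t l) r))

  signature-square : ∀ {n} {S : Square n} → IsSignature S → ∀ j → S j j * S j j ≈ 1#
  signature-square {S = S} (S≈±1 , _) j with S≈±1 j
  ... | inj₁ S≈-1 = trans (*-cong S≈-1 S≈-1) (solve 0 (:- 𝟙 :* :- 𝟙 := 𝟙) refl)
  ... | inj₂ S≈1  = trans (*-cong S≈1 S≈1) (*-identityˡ 1#)

  ownerOf : ∀ {x} → (x ≈ - 1# ⊎ x ≈ 1#) → Player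
  ownerOf (inj₁ _) = min
  ownerOf (inj₂ _) = max

  playerSign : Player → Carrier
  playerSign max = 1#
  playerSign min = - 1#

  ownerOf-sign : ∀ {x} (s : x ≈ - 1# ⊎ x ≈ 1#) → playerSign (ownerOf s) ≈ x
  ownerOf-sign (inj₁ x≈-1) = sym x≈-1
  ownerOf-sign (inj₂ x≈1)  = sym x≈1

  module _ {n} {t : Type n} (G : Game t) where

    open Game G using (owner) renaming (S to gameSignature)

    gameSignature-diagonal : ∀ j → gameSignature j j ≈ playerSign (owner j)
    gameSignature-diagonal j with owner j
    ... | max = Id-diagonal j
    ... | min = -‿cong (Id-diagonal j)

    gameSignature-offDiagonal : ∀ j l → j ≢ l → gameSignature j l ≈ 0#
    gameSignature-offDiagonal j l j≢l with owner j
    ... | max = Id-offDiagonal j≢l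
    ... | min = trans (-‿cong (Id-offDiagonal j≢l)) -0#≈0#

-- From a hidden K-matrix to one vector for all rows

module HiddenK {c ℓ₁ ℓ₂} (ℝ : RealNumbers c ℓ₁ ℓ₂) where

  open OrderedField ℝ
  open Real ℝ
  open Scaling ℝ using (sumᴺ-cong)
  open ZMatrix ℝ
  open RowFamily ℝ using (common-solution)
  open Determinant ℝ using (IsP⇒no-sign-reversal)

  sum-≤-term : ∀ {n} (k : Fin n) {f : Fin n → Carrier} → (∀ i → i ≢ k → f i ≤ 0#) → sum f ≤ f k
  sum-≤-term zero    f≤0 = ≤-respʳ-≈ (+-identityʳ _) (+-monoʳ-≤ _ (sum-nonpos λ i → f≤0 (suc i) λ ()))
  sum-≤-term (suc k) f≤0 = ≤-respʳ-≈ (+-identityˡ _) (+-mono-≤ (f≤0 zero λ ()) (sum-≤-term k λ i i≢k → f≤0 (suc i) (λ { ≡.refl → i≢k ≡.refl })))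

  nonpos-or-all-pos : ∀ {m} (f : Fin m → Carrier) → (∃ λ i → f i ≤ 0#) ⊎ (∀ i → 0# < f i)
  nonpos-or-all-pos {zero}  f = inj₂ λ ()
  nonpos-or-all-pos {suc m} f with <-≤-connex 0# (f zero) | nonpos-or-all-pos (f ∘ suc)
  ... | inj₂ f₀≤0 | _                = inj₁ (zero , f₀≤0)
  ... | inj₁ _    | inj₁ (i , fᵢ≤0)  = inj₁ (suc i , fᵢ≤0)
  ... | inj₁ 0<f₀ | inj₂ 0<f         = inj₂ λ { zero → 0<f₀ ; (suc i) → 0<f i }

  nonneg-weight≈0 : ∀ {x p T} → 0# ≤ x → 0# < p → x * p ≤ T → T ≤ 0# → x ≈ 0#
  nonneg-weight≈0 {x} {p} 0≤x 0<p xp≤T T≤0 = no-zero-divisors (pos⇒≉0 0<p)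
    (≤-antisym (≤-respˡ-≈ (*-comm x p) (≤-trans xp≤T T≤0)) (nonneg*nonneg (<⇒≤ 0<p) 0≤x))

  module _ {n} {a : Type n} (a>0 : ∀ j → NonZero (a j)) (M : BlockMatrix a)
           (hidden : IsHiddenZ M) (M-P : IsBlockP M) where

    open IsHiddenZ hidden

    -- Multiplying `Coefficients` by X gives `Rows`: the identity rows reproduce X, so that X and Y
    -- stand on an equal footing.
    Rows Coefficients : BlockMatrix (a +𝟏)
    Rows         = glue X Y
    Coefficients = glue Id M

    combine : Square n → BlockMatrix a → Square n
    combine A B j l = r j * A j l + sum λ i → s (j , i) * B (j , i) l

    -- The combined row is put first in each block.

    R W : BlockMatrix ((a +𝟏) +𝟏)
    R (j , zero)  = combine Id M j
    R (j , suc k) = Coefficients (j , k)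
    W (j , zero)  = combine X Y j
    W (j , suc k) = Rows (j , k)

    combine-· : ∀ (A : Square n) (B : BlockMatrix a) (x : Vec (Fin n)) j →
      (combine A B ·ᵛ x) j ≈ r j * (A ·ᵛ x) j + sum λ i → s (j , i) * (B ·ᵛ x) (j , i)
    combine-· A B x j = begin-equality
      (sum λ k → (r j * A j k + sum λ i → s (j , i) * B (j , i) k) * x k)
        ≈⟨ (sum-cong-≋ λ k → trans (distribʳ (x k) _ _) (+-congʳ (*-assoc _ _ _))) ⟩
      (sum λ k → r j * (A j k * x k) + (sum λ i → s (j , i) * B (j , i) k) * x k)
        ≈⟨ ∑-distrib-+ (λ k → r j * (A j k * x k)) (λ k → (sum λ i → s (j , i) * B (j , i) k) * x k) ⟩
      (sum λ k → r j * (A j k * x k)) + (sum λ k → (sum λ i → s (j , i) * B (j , i) k) * x k)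
        ≈⟨ +-cong (sym (*-distribˡ-sum (r j) (λ k → A j k * x k))) (sum-assoc (λ i → s (j , i)) (λ i k → B (j , i) k) x) ⟩
      r j * (A ·ᵛ x) j + (sum λ i → s (j , i) * (B ·ᵛ x) (j , i)) ∎

    RX≋W : R · X ≋ W
    RX≋W (j , zero) l = trans (combine-· Id M (λ k → X k l) j)
      (+-cong (*-congˡ (sum-Id* (λ k → X k l) j)) (sum-cong-≋ λ i → *-congˡ (MX≋Y (j , i) l)))
    RX≋W (j , suc k) l = glue₂-elim {a = a} (λ _ (v w : Vec (Fin n)) → (sum λ i → v i * X i l) ≈ w l) Id M X Y
      (λ j → sum-Id* (λ k → X k l) j) (λ j i → MX≋Y (j , i) l) j k

    -- `IsBlockZ` speaks of whole selections. The row (j , i) is put into the selection of first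
    -- rows, which exists because no block is empty.
    Y≤0 : ∀ j i l → j ≢ l → Y (j , i) l ≤ 0#
    Y≤0 j i l j≢l = ≡.subst (λ i → Y (j , i) l ≤ 0#) (≔-at (first ∘ a>0) j i) (Y-Z ((first ∘ a>0) [ j ≔ i ]) j l j≢l)

    Rows≤0 : ∀ j k l → j ≢ l → Rows (j , k) l ≤ 0#
    Rows≤0 j k l j≢l = glue₂-elim {a = a} (λ j (v _ : Vec (Fin n)) → j ≢ l → v l ≤ 0#) X Y X Y
      (λ j → X-Z j l) (λ j i → Y≤0 j i l) j k j≢l

    combine≤0 : IsZ (combine X Y)
    combine≤0 j l j≢l = ≤-respʳ-≈ (+-identityʳ 0#) (+-mono-≤
      (nonneg*nonpos (r≥0 j) (X-Z j l j≢l)) (sum-nonpos λ i → nonneg*nonpos (s≥0 (j , i)) (Y≤0 j i l j≢l)))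

    W-Z : IsBlockZ W
    W-Z B j l j≢l = W≤0 (B j)
      where
      W≤0 : ∀ k → W (j , k) l ≤ 0#
      W≤0 zero    = combine≤0 j l j≢l
      W≤0 (suc k) = Rows≤0 j k l j≢l

    0<columnSum : ∀ l → 0# < sum λ j → combine X Y j l
    0<columnSum l = <-respʳ-≈ (sym (begin-equality
      (sum λ j → combine X Y j l)
        ≈⟨ ∑-distrib-+ (λ j → r j * X j l) (λ j → sum λ i → s (j , i) * Y (j , i) l) ⟩
      (sum λ j → r j * X j l) + (sum λ j → sum λ i → s (j , i) * Y (j , i) l)
        ≈⟨ +-cong (sum-cong-≋ λ j → *-comm (r j) (X j l)) (sumᴺ-cong {b = a} λ t → *-comm (s t) (Y t l)) ⟩
      (X ᵀ ·ᵛ r) l + (Y ᵀ ·ᴺᵛ s) l ∎)) (pos l)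

    -- The column sums make 𝟏 a witness for the transpose; `Semipositive-ᵀ` turns it into one for
    -- the matrix itself.
    combine-semipositive : Semipositive (combine X Y)
    combine-semipositive = Semipositive-ᵀ (combine X Y ᵀ) (IsZ-ᵀ {W = combine X Y} combine≤0)
      ((λ _ → 1#) , (λ _ → <⇒≤ 0<1) , λ l → <-respʳ-≈ (sum-cong-≋ λ j → sym (*-identityʳ (combine X Y j l))) (0<columnSum l))

    0<combine-diagonal : ∀ j → 0# < combine X Y j j
    0<combine-diagonal j = <-≤-trans (0<columnSum j) (sum-≤-term j λ i i≢j → combine≤0 i j i≢j)

    -- A block without weight would have a zero combined row, but the diagonal entry of that row is
    -- at least a positive column sum.
    weights≉0 : ∀ j → r j ≈ 0# → (∀ i → s (j , i) ≈ 0#) → ⊥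
    weights≉0 j r≈0 s≈0 = pos⇒≉0 (0<combine-diagonal j) (trans
      (+-cong (trans (*-congʳ r≈0) (zeroˡ _)) (sum-≈0 λ i → trans (*-congʳ {Y (j , i) j} (s≈0 i)) (zeroˡ _)))
      (+-identityˡ 0#))

    -- Reversal by any row of R in block j is inherited by some row of M there. An identity row
    -- forces `z j` to vanish, and then any row will do. For the combined row, a nonnegative
    -- combination of the square of `z j` and the products `z j * (M ·ᵛ z) (j , i)` is at most zero;
    -- if all these products were positive, so would be the square, and every weight in the block
    -- would vanish.
    M-row : ∀ (z : Vec (Fin n)) j k → z j * (R ·ᵛ z) (j , k) ≤ 0# → ∃ λ i → z j * (M ·ᵛ z) (j , i) ≤ 0#
    M-row z j (suc k) = glue₂-elim {a = a} (λ j (v _ : Vec (Fin n)) → z j * (sum λ l → v l * z l) ≤ 0# → ∃ λ i → z j * (M ·ᵛ z) (j , i) ≤ 0#)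
      Id M Id M
      (λ j zz≤0 → first (a>0 j) , ≤-reflexive (trans (*-congʳ (square≤0 (≤-respˡ-≈ (*-congˡ (sum-Id* z j)) zz≤0))) (zeroˡ _)))
      (λ j i zMz≤0 → i , zMz≤0) j k
      where
      square≤0 : ∀ {x} → x * x ≤ 0# → x ≈ 0#
      square≤0 {x} xx≤0 with compare x 0#
      ... | tri≈ _ x≈0 _ = x≈0
      ... | tri< _ x≉0 _ = contradiction xx≤0 (<⇒≱ (0<square x≉0))
      ... | tri> _ x≉0 _ = contradiction xx≤0 (<⇒≱ (0<square x≉0))
    M-row z j zero zRz≤0 with nonpos-or-all-pos (λ i → z j * (M ·ᵛ z) (j , i))
    ... | inj₁ found   = found
    ... | inj₂ 0<zMz   = ⊥-elim (weights≉0 j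
      (nonneg-weight≈0 (r≥0 j) (0<square z≉0) rzz≤T T≤0)
      (λ i → nonneg-weight≈0 (s≥0 (j , i)) (0<zMz i) (szMz≤T i) T≤0))
      where
      i₀ : Fin (a j)
      i₀ = first (a>0 j)
      z≉0 : ¬ (z j ≈ 0#)
      z≉0 z≈0 = irrefl (sym (trans (*-congʳ z≈0) (zeroˡ _))) (0<zMz i₀)
      term : Fin (a j) → Carrier
      term i = s (j , i) * (z j * (M ·ᵛ z) (j , i))
      T : Carrier
      T = r j * (z j * z j) + sum term
      0≤term : ∀ i → 0# ≤ term i
      0≤term i = nonneg*nonneg (s≥0 (j , i)) (<⇒≤ (0<zMz i))
      0≤rzz : 0# ≤ r j * (z j * z j)
      0≤rzz = nonneg*nonneg (r≥0 j) (0≤square (z j))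
      rzz≤T : r j * (z j * z j) ≤ T
      rzz≤T = ≤-respˡ-≈ (+-identityʳ _) (+-monoʳ-≤ _ (sum-nonneg 0≤term))
      szMz≤T : ∀ i → term i ≤ T
      szMz≤T i = ≤-respˡ-≈ (+-identityˡ _) (+-mono-≤ 0≤rzz (sum-≥-term 0≤term i))
      T≤0 : T ≤ 0#
      T≤0 = ≤-respˡ-≈ (begin-equality
        z j * (combine Id M ·ᵛ z) j
          ≈⟨ *-congˡ (trans (combine-· Id M z j) (+-congʳ (*-congˡ (sum-Id* z j)))) ⟩
        z j * (r j * z j + sum λ i → s (j , i) * (M ·ᵛ z) (j , i))
          ≈⟨ distribˡ (z j) _ _ ⟩
        z j * (r j * z j) + z j * (sum λ i → s (j , i) * (M ·ᵛ z) (j , i))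
          ≈⟨ +-cong (solve 2 (λ z r → z :* (r :* z) := r :* (z :* z)) refl (z j) (r j))
                    (trans (*-distribˡ-sum (z j) (λ i → s (j , i) * (M ·ᵛ z) (j , i)))
                      (sum-cong-≋ λ i → solve 3 (λ z s m → z :* (s :* m) := s :* (z :* m)) refl (z j) (s (j , i)) ((M ·ᵛ z) (j , i)))) ⟩
        T ∎) zRz≤0

    no-reversal : ∀ (B : MaxCompl ((a +𝟏) +𝟏)) z → (∀ j → z j * (R ·ᵛ z) (j , B j) ≤ 0#) → ∀ j → z j ≈ 0#
    no-reversal B z zRz≤0 = IsP⇒no-sign-reversal (representative M (λ j → proj₁ (choice j))) (M-P (λ j → proj₁ (choice j))) z (λ j → proj₂ (choice j))
      where
      choice : ∀ j → ∃ λ i → z j * (M ·ᵛ z) (j , i) ≤ 0#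
      choice j = M-row z j (B j) (zRz≤0 j)

    semipositive-rows : ∃ λ t → (∀ j → 0# ≤ t j) × (∀ r → 1# ≤ (Rows ·ᵛ t) r)
    semipositive-rows = proj₁ solution , proj₁ (proj₂ solution) , λ (j , k) → proj₂ (proj₂ solution) (j , suc k)
      where
      solution : ∃ λ t → (∀ j → 0# ≤ t j) × (∀ r → 1# ≤ (W ·ᵛ t) r)
      -- Index zero in every block selects exactly the combined rows, from which the exchange
      -- starts.
      solution = common-solution R W X RX≋W W-Z no-reversal (λ _ → zero) combine-semipositive

-- The game built from X, Y and t

module GameConstruction {c ℓ₁ ℓ₂} (ℝ : RealNumbers c ℓ₁ ℓ₂) where

  open OrderedField ℝ
  open Real ℝ
  open Scaling ℝ
  open Signature ℝ
  open ZMatrix ℝ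
  open HiddenK ℝ using (sum-≤-term; semipositive-rows; Rows≤0)

  Id-scale : ∀ {n} (x y : Fin n → Carrier) → (∀ j → x j * y j ≈ 1#) → ∀ j l → x j * y l * Id j l ≈ Id j l
  Id-scale x y xy≈1 j l with j Fin.≟ l
  ... | yes ≡.refl = trans (*-identityʳ _) (xy≈1 j)
  ... | no  _      = zeroʳ _

  ≤-Id : ∀ {n} {j l : Fin n} {x} → (j ≡ l → x ≤ 1#) → (j ≢ l → x ≤ 0#) → x ≤ Id j l
  ≤-Id {j = j} {l} x≤1 x≤0 with j Fin.≟ l
  ... | yes j≡l = x≤1 j≡l
  ... | no  j≢l = x≤0 j≢l

  module _ {n} {a : Type n} (X : Square n) (Y : BlockMatrix a) (t : Vec (Fin n))
    (0≤t : ∀ j → 0# ≤ t j) (1≤d : ∀ r → 1# ≤ (glue X Y ·ᵛ t) r)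
    (L≤0 : ∀ j k l → j ≢ l → glue X Y (j , k) l ≤ 0#)
    where

    L : BlockMatrix (a +𝟏)
    L = glue X Y

    d e : Vec (N (a +𝟏))
    d = L ·ᵛ t
    0<d : ∀ r → 0# < d r
    0<d r = <-≤-trans 0<1 (1≤d r)
    e r = recip (0<d r)
    de≈1 : ∀ r → d r * e r ≈ 1#
    de≈1 r = *-recip (0<d r)
    0<e : ∀ r → 0# < e r
    0<e r = recip-pos (0<d r)
    -- Here the bound 1 on the row sums counts: a diagonal entry of `scaled` is e times
    -- `δ * diagonal`, and both factors are at most 1.
    e≤1 : ∀ r → e r ≤ 1#
    e≤1 r = ≤-respˡ-≈ (*-identityʳ (e r)) (≤-respʳ-≈ (trans (*-comm _ _) (de≈1 r)) (*-monoˡ-≤ (<⇒≤ (0<e r)) (1≤d r)))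

    diagonal : Vec (N (a +𝟏))
    diagonal (j , k) = L (j , k) j * t j

    -- The other terms of the row sum d are nonpositive, so the diagonal term is at least d.
    0<diagonal : ∀ r → 0# < diagonal r
    0<diagonal (j , k) = <-≤-trans (0<d (j , k)) (sum-≤-term j λ l l≢j → nonpos*nonneg (L≤0 j k l (l≢j ∘ ≡.sym)) (0≤t l))

    0<t : ∀ j → 0# < t j
    0<t j = pos-right (<⇒≤ (pos-left (0≤t j) (0<diagonal (j , zero)))) (0<diagonal (j , zero))

    ∑diagonal : Carrier
    ∑diagonal = sumᴺ {b = a +𝟏} diagonal
    diagonal≤∑ : ∀ r → diagonal r ≤ ∑diagonal
    diagonal≤∑ (j , k) = ≤-trans (sum-≥-term (λ k → <⇒≤ (0<diagonal (j , k))) k)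
      (sum-≥-term {f = λ j → sum λ k → diagonal (j , k)} (λ j → sum-nonneg (λ k → <⇒≤ (0<diagonal (j , k)))) j)
    0≤∑diagonal : 0# ≤ ∑diagonal
    0≤∑diagonal = sum-nonneg (λ j → sum-nonneg (λ k → <⇒≤ (0<diagonal (j , k))))

    -- Δ = 1 / (1 - γ) bounds all diagonal entries, which keeps P nonnegative.

    Δ δ γ : Carrier
    Δ = 1# + (1# + ∑diagonal)
    0<1+∑ : 0# < 1# + ∑diagonal
    0<1+∑ = pos+nonneg 0<1 0≤∑diagonal
    0<Δ : 0# < Δ
    0<Δ = pos+nonneg 0<1 (<⇒≤ 0<1+∑)
    δ = recip 0<Δ
    γ = 1# - δ
    Δδ≈1 : Δ * δ ≈ 1#
    Δδ≈1 = *-recip 0<Δ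
    0<δ : 0# < δ
    0<δ = recip-pos 0<Δ
    -- P is obtained by dividing by γ, so Δ has to exceed 1. The second `1#` in Δ ensures this even
    -- when there are no states and `∑diagonal` is zero.
    0<γ : 0# < γ
    0<γ = <-respʳ-≈ (begin-equality
      δ * (1# + ∑diagonal)   ≈⟨ solve 2 (λ δ y → δ :* y := (𝟙 :+ y) :* δ :- δ) refl δ (1# + ∑diagonal) ⟩
      Δ * δ - δ              ≈⟨ +-congʳ Δδ≈1 ⟩
      1# - δ                 ∎) (*-pos _ _ 0<δ 0<1+∑)
    γ<1 : γ < 1#
    γ<1 = 0<-⇒< (<-respʳ-≈ (solve 1 (λ δ → δ := 𝟙 :- (𝟙 :- δ)) refl δ) 0<δ)
    δ*diagonal≤1 : ∀ r → δ * diagonal r ≤ 1#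
    δ*diagonal≤1 r = begin
      δ * diagonal r      ≤⟨ *-monoˡ-≤ (<⇒≤ 0<δ) (diagonal≤∑ r) ⟩
      δ * ∑diagonal       ≤⟨ *-monoˡ-≤ (<⇒≤ 0<δ) (≤-respˡ-≈ (trans (+-identityˡ _) (+-identityˡ _)) (+-mono-≤ (<⇒≤ 0<1) (+-monoˡ-≤ ∑diagonal (<⇒≤ 0<1)))) ⟩
      δ * Δ               ≈⟨ trans (*-comm δ Δ) Δδ≈1 ⟩
      1#                  ∎

    γ⁻¹ : Carrier
    γ⁻¹ = recip 0<γ

    scaled : BlockMatrix (a +𝟏)
    scaled r l = δ * e r * L r l * t l

    -- Solved from Id - γP = `scaled`. The rows of `scaled` sum to δ = 1 - γ, which makes those of P
    -- sum to 1.
    P : BlockMatrix (a +𝟏)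
    P (j , k) l = γ⁻¹ * (Id j l - scaled (j , k) l)

    Id-γP≈scaled : ∀ j k l → Id j l - γ * P (j , k) l ≈ scaled (j , k) l
    Id-γP≈scaled j k l = begin-equality
      Id j l - γ * (γ⁻¹ * (Id j l - scaled (j , k) l))   ≈⟨ +-congˡ (-‿cong (trans (sym (*-assoc γ γ⁻¹ _)) (trans (*-congʳ (*-recip 0<γ)) (*-identityˡ _)))) ⟩
      Id j l - (Id j l - scaled (j , k) l)               ≈⟨ solve 2 (λ x y → x :- (x :- y) := y) refl (Id j l) (scaled (j , k) l) ⟩
      scaled (j , k) l                                   ∎

    P≥0 : ∀ r l → 0# ≤ P r l
    P≥0 (j , k) l = nonneg*nonneg (<⇒≤ (recip-pos 0<γ)) (≤⇒0≤- (≤-Id scaled≤1 scaled≤0))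
      where
      scaled≤1 : j ≡ l → scaled (j , k) l ≤ 1#
      scaled≤1 ≡.refl = begin
        δ * e (j , k) * L (j , k) j * t j   ≈⟨ solve 4 (λ δ e x t → δ :* e :* x :* t := e :* (δ :* (x :* t))) refl δ (e (j , k)) (L (j , k) j) (t j) ⟩
        e (j , k) * (δ * diagonal (j , k))  ≤⟨ *-monoˡ-≤ (<⇒≤ (0<e (j , k))) (δ*diagonal≤1 (j , k)) ⟩
        e (j , k) * 1#                      ≈⟨ *-identityʳ _ ⟩
        e (j , k)                           ≤⟨ e≤1 (j , k) ⟩
        1#                                  ∎
      scaled≤0 : j ≢ l → scaled (j , k) l ≤ 0#
      scaled≤0 j≢l = nonpos*nonneg (nonneg*nonpos (nonneg*nonneg (<⇒≤ 0<δ) (<⇒≤ (0<e (j , k)))) (L≤0 j k l j≢l)) (0≤t l)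

    ∑P≈1 : ∀ r → sum (P r) ≈ 1#
    ∑P≈1 r@(j , k) = begin-equality
      (sum λ l → γ⁻¹ * (Id j l - scaled r l))
        ≈⟨ *-distribˡ-sum γ⁻¹ (λ l → Id j l - scaled r l) ⟨
      γ⁻¹ * (sum λ l → Id j l - scaled r l)
        ≈⟨ *-congˡ (trans (sum-minus (Id j) (scaled r)) (+-cong ∑Id≈1 (-‿cong ∑scaled≈δ))) ⟩
      γ⁻¹ * (1# - δ)
        ≈⟨ trans (*-comm γ⁻¹ γ) (*-recip 0<γ) ⟩
      1# ∎
      where
      ∑Id≈1 : sum (Id j) ≈ 1#
      ∑Id≈1 = trans (sum-cong-≋ λ l → sym (*-identityʳ (Id j l))) (sum-Id* (λ _ → 1#) j)
      ∑scaled≈δ : sum (scaled r) ≈ δ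
      ∑scaled≈δ = begin-equality
        sum (scaled r)                          ≈⟨ (sum-cong-≋ λ l → *-assoc (δ * e r) (L r l) (t l)) ⟩
        (sum λ l → δ * e r * (L r l * t l))     ≈⟨ *-distribˡ-sum (δ * e r) (λ l → L r l * t l) ⟨
        δ * e r * d r                           ≈⟨ solve 3 (λ δ e d → δ :* e :* d := δ :* (d :* e)) refl δ (e r) (d r) ⟩
        δ * (d r * e r)                         ≈⟨ trans (*-congˡ (de≈1 r)) (*-identityʳ δ) ⟩
        δ                                       ∎

    game : (Fin n → Player) → Vec (N a) → Game (a +𝟏)
    game owner q = record
      { owner  = owner
      -- With zero rewards in C, q′ is minus the remaining rewards, hence the sign here; the factor
      -- e is the row scaling that M′ carries relative to M.
      ; reward = glue (λ _ → 0#) (λ (j , i) → - (e (j , inject₁ i) * q (j , i)))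
      ; P      = P
      ; P≥0    = P≥0
      ; ∑P≈1   = ∑P≈1
      ; γ      = γ
      ; 0≤γ    = <⇒≤ 0<γ
      ; γ<1    = γ<1
      }

    module _ (M : BlockMatrix a) (X⁻¹ : Square n) (XX⁻¹≋Id : X · X⁻¹ ≋ Id) (X⁻¹X≋Id : X⁻¹ · X ≋ Id) (YX⁻¹≋M : Y · X⁻¹ ≋ M) where

      lastCol : Fin n → Carrier
      lastCol l = d (l , fromℕ (a l))
      t⁻¹ : Fin n → Carrier
      t⁻¹ l = recip (0<t l)
      tt⁻¹≈1 : ∀ l → t l * t⁻¹ l ≈ 1#
      tt⁻¹≈1 l = *-recip (0<t l)

      -- At the rows in C, Id - γP is X with rows scaled by δe and columns by t. In its inverse, Δ
      -- undoes δ and `lastCol` undoes e.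
      V : Square n
      V k l = Δ * t⁻¹ k * X⁻¹ k l * lastCol l

      -- The factors t and δ meet their reciprocals for every row r. At the rows in C this yields
      -- the identity, at the others M with rows scaled by e and columns by `lastCol`.
      scaled·V : ∀ r l → (scaled · V) r l ≈ e r * (L · X⁻¹) r l * lastCol l
      scaled·V r l = begin-equality
        (sum λ k → δ * e r * L r k * t k * (Δ * t⁻¹ k * X⁻¹ k l * lastCol l))
          ≈⟨ (sum-cong-≋ λ k → trans
               (solve 8 (λ δ e x t Δ t⁻¹ y d → δ :* e :* x :* t :* (Δ :* t⁻¹ :* y :* d) := (Δ :* δ) :* (t :* t⁻¹) :* (e :* (x :* y) :* d)) refl
                 δ (e r) (L r k) (t k) Δ (t⁻¹ k) (X⁻¹ k l) (lastCol l))
               (trans (*-congʳ (*-cong Δδ≈1 (tt⁻¹≈1 k))) (trans (*-congʳ (*-identityˡ 1#)) (*-identityˡ _)))) ⟩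
        (sum λ k → e r * (L r k * X⁻¹ k l) * lastCol l)
          ≈⟨ *-distribʳ-sum (lastCol l) (λ k → e r * (L r k * X⁻¹ k l)) ⟨
        (sum λ k → e r * (L r k * X⁻¹ k l)) * lastCol l
          ≈⟨ *-congʳ (sym (*-distribˡ-sum (e r) (λ k → L r k * X⁻¹ k l))) ⟩
        e r * (L · X⁻¹) r l * lastCol l ∎

      L-last : ∀ j l → L (j , fromℕ (a j)) l ≈ X j l
      L-last j l = reflexive (≡.cong (λ row → row l) (glue-fromℕ X Y j))
      L-other : ∀ j i l → L (j , inject₁ i) l ≈ Y (j , i) l
      L-other j i l = reflexive (≡.cong (λ row → row l) (glue-inject₁ X Y j i))

      module _ (owner : Fin n → Player) (q : Vec (N a)) where

        G : Game (a +𝟏)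
        G = game owner q

        right : (Id ⊖ γ ∙ atC {a = a} P) · V ≋ Id
        right j l = begin-equality
          (sum λ k → (Id j k - γ * P (j , fromℕ (a j)) k) * V k l)
            ≈⟨ (sum-cong-≋ λ k → *-congʳ {V k l} (Id-γP≈scaled j (fromℕ (a j)) k)) ⟩
          (scaled · V) (j , fromℕ (a j)) l
            ≈⟨ scaled·V (j , fromℕ (a j)) l ⟩
          e (j , fromℕ (a j)) * (L · X⁻¹) (j , fromℕ (a j)) l * lastCol l
            ≈⟨ *-congʳ (*-congˡ (trans (sum-cong-≋ λ k → *-congʳ {X⁻¹ k l} (L-last j k)) (XX⁻¹≋Id j l))) ⟩
          e (j , fromℕ (a j)) * Id j l * lastCol l
            ≈⟨ solve 3 (λ e i d → e :* i :* d := e :* d :* i) refl (e (j , fromℕ (a j))) (Id j l) (lastCol l) ⟩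
          e (j , fromℕ (a j)) * lastCol l * Id j l
            ≈⟨ Id-scale (λ j → e (j , fromℕ (a j))) lastCol (λ j → trans (*-comm _ _) (de≈1 (j , fromℕ (a j)))) j l ⟩
          Id j l ∎

        left : V · (Id ⊖ γ ∙ atC {a = a} P) ≋ Id
        left k l = begin-equality
          (sum λ j → V k j * (Id j l - γ * P (j , fromℕ (a j)) l))
            ≈⟨ (sum-cong-≋ λ j → trans
                 (*-congˡ {V k j} (trans (Id-γP≈scaled j (fromℕ (a j)) l) (*-congʳ (*-congˡ (L-last j l)))))
                 (trans (solve 8 (λ Δ t⁻¹ y d δ e x t → Δ :* t⁻¹ :* y :* d :* (δ :* e :* x :* t) := (Δ :* δ) :* (d :* e) :* (t⁻¹ :* t :* (y :* x))) refl
                          Δ (t⁻¹ k) (X⁻¹ k j) (lastCol j) δ (e (j , fromℕ (a j))) (X j l) (t l))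
                        (trans (*-congʳ (*-cong Δδ≈1 (de≈1 (j , fromℕ (a j))))) (trans (*-congʳ (*-identityˡ 1#)) (*-identityˡ _))))) ⟩
          (sum λ j → t⁻¹ k * t l * (X⁻¹ k j * X j l))
            ≈⟨ *-distribˡ-sum (t⁻¹ k * t l) (λ j → X⁻¹ k j * X j l) ⟨
          t⁻¹ k * t l * (X⁻¹ · X) k l
            ≈⟨ *-congˡ (X⁻¹X≋Id k l) ⟩
          t⁻¹ k * t l * Id k l
            ≈⟨ Id-scale t⁻¹ t (λ k → trans (*-comm _ _) (tt⁻¹≈1 k)) k l ⟩
          Id k l ∎

        M′ : BlockMatrix a
        M′ = (E a ⊖ γ ∙ atC̅ {a = a} P) · V

        M′≈eMd : ∀ j i l → M′ (j , i) l ≈ e (j , inject₁ i) * M (j , i) l * lastCol l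
        M′≈eMd j i l = begin-equality
          (sum λ k → (Id j k - γ * P (j , inject₁ i) k) * V k l)
            ≈⟨ (sum-cong-≋ λ k → *-congʳ {V k l} (Id-γP≈scaled j (inject₁ i) k)) ⟩
          (scaled · V) (j , inject₁ i) l
            ≈⟨ scaled·V (j , inject₁ i) l ⟩
          e (j , inject₁ i) * (L · X⁻¹) (j , inject₁ i) l * lastCol l
            ≈⟨ *-congʳ (*-congˡ (trans (sum-cong-≋ λ k → *-congʳ {X⁻¹ k l} (L-other j i k)) (YX⁻¹≋M (j , i) l))) ⟩
          e (j , inject₁ i) * M (j , i) l * lastCol l ∎

        q′ : Vec (N a)
        q′ r = (M′ ·ᵛ atC {a = a} (Game.reward G)) r - atC̅ {a = a} (Game.reward G) r

        q′≈eq : ∀ j i → q′ (j , i) ≈ e (j , inject₁ i) * q (j , i)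
        q′≈eq j i = begin-equality
          (M′ ·ᵛ atC {a = a} (Game.reward G)) (j , i) - Game.reward G (j , inject₁ i)
            ≈⟨ +-cong (sum-≈0 λ l → trans (*-congˡ {M′ (j , i) l} (reflexive (glue-fromℕ rewardC rewardC̅ l))) (zeroʳ _))
                      (-‿cong (reflexive (glue-inject₁ rewardC rewardC̅ j i))) ⟩
          0# - - (e (j , inject₁ i) * q (j , i))
            ≈⟨ solve 1 (λ x → 𝟘 :- :- x := x) refl (e (j , inject₁ i) * q (j , i)) ⟩
          e (j , inject₁ i) * q (j , i) ∎
          where
          rewardC : Fin n → Carrier
          rewardC _ = 0#
          rewardC̅ : N a → Carrier
          rewardC̅ (j , i) = - (e (j , inject₁ i) * q (j , i))

        module _ (S : Square n) (S-diagonal : ∀ j l → j ≢ l → S j l ≈ 0#) (owner-sign : ∀ j → playerSign (owner j) ≈ S j j) where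

          S′ : Square n
          S′ = Game.S G

          S′≈S : ∀ j → S′ j j ≈ S j j
          S′≈S j = trans (gameSignature-diagonal G j) (owner-sign j)

          S′-diagonal : ∀ j l → j ≢ l → S′ j l ≈ 0#
          S′-diagonal = gameSignature-offDiagonal G

          -- Diagonal matrices commute, so the signs of the owners pass through the positive scaling
          -- that relates M′ to M.
          game-scaled : Scaled (blockSignature a S ·ᴺ M · S) (blockSignature a S′ ·ᴺ M′ · S′)
                               (blockSignature a S ·ᴺᵛ q) (blockSignature a S′ ·ᴺᵛ q′)
          game-scaled = record
            { ρ = λ (j , i) → e (j , inject₁ i) ; ρ⁻¹ = λ (j , i) → d (j , inject₁ i)
            ; κ = lastCol ; κ⁻¹ = λ l → e (l , fromℕ (a l))
            ; 0<ρ = λ (j , i) → 0<e (j , inject₁ i) ; 0<ρ⁻¹ = λ (j , i) → 0<d (j , inject₁ i)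
            ; 0<κ = λ l → 0<d (l , fromℕ (a l)) ; 0<κ⁻¹ = λ l → 0<e (l , fromℕ (a l))
            ; ρρ⁻¹≈1 = λ (j , i) → trans (*-comm _ _) (de≈1 (j , inject₁ i))
            ; κκ⁻¹≈1 = λ l → de≈1 (l , fromℕ (a l))
            ; A′≈ρAκ = λ (j , i) l → begin-equality
                (blockSignature a S′ ·ᴺ M′ · S′) (j , i) l
                  ≈⟨ signature-conjugate S′ S′-diagonal M′ (j , i) l ⟩
                S′ j j * M′ (j , i) l * S′ l l
                  ≈⟨ *-cong (*-cong (S′≈S j) (M′≈eMd j i l)) (S′≈S l) ⟩
                S j j * (e (j , inject₁ i) * M (j , i) l * lastCol l) * S l l
                  ≈⟨ solve 5 (λ s e m d s′ → s :* (e :* m :* d) :* s′ := e :* (s :* m :* s′) :* d) refl (S j j) (e (j , inject₁ i)) (M (j , i) l) (lastCol l) (S l l) ⟩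
                e (j , inject₁ i) * (S j j * M (j , i) l * S l l) * lastCol l
                  ≈⟨ *-congʳ (*-congˡ (signature-conjugate S S-diagonal M (j , i) l)) ⟨
                e (j , inject₁ i) * (blockSignature a S ·ᴺ M · S) (j , i) l * lastCol l ∎
            ; q′≈ρq = λ (j , i) → begin-equality
                (blockSignature a S′ ·ᴺᵛ q′) (j , i)             ≈⟨ blockSignature-·ᴺᵛ S′ S′-diagonal q′ (j , i) ⟩
                S′ j j * q′ (j , i)                              ≈⟨ *-cong (S′≈S j) (q′≈eq j i) ⟩
                S j j * (e (j , inject₁ i) * q (j , i))          ≈⟨ solve 3 (λ s e q → s :* (e :* q) := e :* (s :* q)) refl (S j j) (e (j , inject₁ i)) (q (j , i)) ⟩
                e (j , inject₁ i) * (S j j * q (j , i))          ≈⟨ *-congˡ (blockSignature-·ᴺᵛ S S-diagonal q (j , i)) ⟨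
                e (j , inject₁ i) * (blockSignature a S ·ᴺᵛ q) (j , i) ∎
            }

          arises : ∀ {O : Orientation (a +𝟏)} →
            ArisesFromPGLCP (blockSignature a S ·ᴺ M · S) (blockSignature a S ·ᴺᵛ q) O → ArisesFromGame G O
          arises A = record
            { V         = V
            ; isInverse = right , left
            ; arises    = ArisesFromPGLCP-scale {A = blockSignature a S ·ᴺ M · S} {blockSignature a S′ ·ᴺ M′ · S′} {blockSignature a S ·ᴺᵛ q} {blockSignature a S′ ·ᴺᵛ q′} game-scaled A
            }

-- The orientation of the P-GLCP and its game

module HiddenKGame {c ℓ₁ ℓ₂} (ℝ : RealNumbers c ℓ₁ ℓ₂) where

  open OrderedField ℝ
  open Real ℝ
  open Scaling ℝ
  open Signature ℝ
  open ZMatrix ℝ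
  open HiddenK ℝ using (semipositive-rows; Rows≤0)
  open GameConstruction ℝ using (game; arises)

  -- The orientation is the defining condition of `direction` itself, which makes that equivalence
  -- an identity.
  P-GLCP : ∀ {n} {a : Type n} → BlockMatrix a → Vec (N a) → Orientation (a +𝟏)
  P-GLCP {a = a} M q {B} e = ∃ λ V → IsInverseᴺ {b = a} (nonbasis M B) V × (_·ᴺᵛ_ {b = a} V q) (entering e) < 0#

  P-GLCP-arises : ∀ {n} {a : Type n} {M : BlockMatrix a} {q} → IsBlockP M → Nondegenerate M q →
                  ArisesFromPGLCP M q (P-GLCP M q)
  P-GLCP-arises M-P nondegenerate = record
    { isP = M-P ; nondegenerate = nondegenerate ; direction = λ e → mk⇔ id id }

  module _ {n} {a : Type n} (a>0 : ∀ j → NonZero (a j)) (M : BlockMatrix a)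
           (hidden : IsHiddenZ M) (M-P : IsBlockP M) (S : Square n) (S-signature : IsSignature S) (q : Vec (N a)) where

    open IsHiddenZ hidden using (X; Y; X-Z; MX≋Y)

    SMS : BlockMatrix a
    SMS = blockSignature a S ·ᴺ M · S

    Sq : Vec (N a)
    Sq = blockSignature a S ·ᴺᵛ q

    -- Conjugation by S multiplies a principal minor by a product of squares of signs, that is by 1.
    SMS-P : IsBlockP SMS
    SMS-P = IsBlockP-scale {A = M} {SMS} (λ (j , _) → S j j) (λ l → S l l)
      (λ j _ → <-respʳ-≈ (sym (signature-square S-signature j)) 0<1)
      (signature-conjugate S (proj₂ S-signature) M) M-P

    game-from-inverse : ∀ t → (∀ j → 0# ≤ t j) → (∀ r → 1# ≤ (glue X Y ·ᵛ t) r) →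
      (∃ λ X⁻¹ → IsInverse X X⁻¹ × (∀ j l → 0# ≤ X⁻¹ j l)) →
      ∀ {O : Orientation (a +𝟏)} → ArisesFromPGLCP SMS Sq O → Σ[ G ∈ Game (a +𝟏) ] ArisesFromGame G O
    game-from-inverse t 0≤t 1≤Lt (X⁻¹ , (XX⁻¹≋Id , X⁻¹X≋Id) , _) A =
      game X Y t 0≤t 1≤Lt L≤0 owner q ,
      arises X Y t 0≤t 1≤Lt L≤0 M X⁻¹ XX⁻¹≋Id X⁻¹X≋Id YX⁻¹≋M owner q S (proj₂ S-signature) (λ j → ownerOf-sign (proj₁ S-signature j)) A
      where
      owner : Fin n → Player
      owner j = ownerOf (proj₁ S-signature j)
      L≤0 : ∀ j k l → j ≢ l → glue X Y (j , k) l ≤ 0#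
      L≤0 = Rows≤0 a>0 M hidden M-P
      YX⁻¹≋M : Y · X⁻¹ ≋ M
      YX⁻¹≋M r l = begin-equality
        (Y · X⁻¹) r l                       ≈⟨ ·ᵛ-congˡ MX≋Y (λ k → X⁻¹ k l) r ⟨
        ((M · X) ·ᵛ (λ k → X⁻¹ k l)) r      ≈⟨ ·ᵛ-assoc M X (λ k → X⁻¹ k l) r ⟩
        (M ·ᵛ (λ k → (X · X⁻¹) k l)) r      ≈⟨ ·ᵛ-congʳ M (λ k → XX⁻¹≋Id k l) r ⟩
        (M ·ᵛ (λ k → Id k l)) r             ≈⟨ sum-*Id (M r) l ⟩
        M r l                               ∎

    -- The rows of X are among those of `glue X Y`, so t makes X semipositive. A semipositive
    -- Z-matrix is invertible, and this allows M to be written as Y times the inverse of X.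
    game-from-rows : (∃ λ t → (∀ j → 0# ≤ t j) × (∀ r → 1# ≤ (glue X Y ·ᵛ t) r)) →
      ∀ {O : Orientation (a +𝟏)} → ArisesFromPGLCP SMS Sq O → Σ[ G ∈ Game (a +𝟏) ] ArisesFromGame G O
    game-from-rows (t , 0≤t , 1≤Lt) = game-from-inverse t 0≤t 1≤Lt
      (nonneg-inverse X X-Z (t , 0≤t , λ j → <-≤-trans 0<1
        (≡.subst (λ row → 1# ≤ sum λ l → row l * t l) (glue-fromℕ X Y j) (1≤Lt (j , fromℕ (a j))))))

    game-exists : Nondegenerate SMS Sq →
      Σ[ G ∈ Game (a +𝟏) ] Σ[ O ∈ Orientation (a +𝟏) ] (ArisesFromPGLCP SMS Sq O × ArisesFromGame G O)
    game-exists nondegenerate = proj₁ found , P-GLCP SMS Sq , A , proj₂ found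
      where
      A : ArisesFromPGLCP SMS Sq (P-GLCP SMS Sq)
      A = P-GLCP-arises SMS-P nondegenerate
      found : Σ[ G ∈ Game (a +𝟏) ] ArisesFromGame G (P-GLCP SMS Sq)
      found = game-from-rows (semipositive-rows a>0 M hidden M-P) A

proposition10p2 : ∀ {c ℓ₁ ℓ₂} (ℝ : RealNumbers c ℓ₁ ℓ₂) → let open Real ℝ in
    ∀ {n : ℕ} (a : Type n) → (∀ j → NonZero (a j)) →
    (M : BlockMatrix a) → IsHiddenK M →
    (S : Square n) → IsSignature S →
    (q : Vec (N a)) →
    let SMS = blockSignature a S ·ᴺ M · S
        Sq  = blockSignature a S ·ᴺᵛ q
    in
    IsBlockP SMS ×
    (Nondegenerate SMS Sq →
      Σ[ G ∈ Game (a +𝟏) ] Σ[ O ∈ Orientation (a +𝟏) ]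
        (ArisesFromPGLCP SMS Sq O × ArisesFromGame G O))
proposition10p2 ℝ a a>0 M (hidden , M-P) S S-signature q =
  SMS-P a>0 M hidden M-P S S-signature q , game-exists a>0 M hidden M-P S S-signature q
  where open HiddenKGame ℝ
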